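{- Let $H$ be a bipartite graph. If $n$ is even and sufficiently large, then $\mathrm{rex}(n,H,K_3)=\mathcal{N}(H,T(n,2))$. If $H$ is a tree and $n$ is odd and sufficiently large, then $\mathrm{rex}(n,H,K_3)=\mathcal{N}(H,G^*)$, where $G^*$ is a (suitable) regular graph obtained by deleting some edges of an $n$-vertex blow-up of $C_5$.
   Context: All graphs are finite and simple. $\mathcal{N}(H,G)$ denotes the number of (not necessarily induced) copies of $H$ in $G$. A graph is $F$-free if it does not contain $F$ as a (not necessarily induced) subgraph. For graphs $H,F$ and a positive integer $n$, $\mathrm{rex}(n,H,F):=\max\{\mathcal{N}(H,G): G \text{ is an } F\text{ -free regular } n\text{ -vertex graph}\}$. $T(n,2)$ is the complete bipartite graph on $n$ vertices with parts of order $\lfloor n/2\rfloor$ and $\lceil n/2\rceil$. $C_5$ is the cycle on 5 vertices. A blow-up of a graph $Q$ is a graph obtained by replacing each vertex of $Q$ by an independent set of vertices (not necessarily of equal sizes) and each edge $uv\in E(Q)$ by a complete bipartite graph between the independent sets replacing $u$ and $v$. "Sufficiently large" means larger than some constant depending on $H$. The second statement asserts that there exists such a graph $G^*$ on $n$ vertices attaining the maximum. -}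

module Defs where

open import Data.Bool using (Bool)
import Data.Bool.Properties as Bool
open import Data.Fin using (Fin; toℕ; finToFun; _≟_)
open import Data.Fin.Properties using (all?; any?; toℕ<n)
open import Data.Fin.Subset using (Subset; ∣_∣)
open import Data.List using (List; length; map; filter; deduplicate; allFin)
open import Data.Nat as ℕ using (ℕ; suc; _+_; _^_; _≤_; _<?_; ⌊_/2⌋; NonZero)
open import Data.Nat.DivMod using (_%_; m<n⇒m%n≡m; n%n≡0)
open import Data.Nat.Properties using (m≢1+m+n; +-identityʳ; ≤-antisym; ≮⇒≥)
open import Data.Product using (Σ; ∃; ∃-syntax; _×_; _,_)
open import Data.Product.Properties using (≡-dec)
open import Data.Sum using (_⊎_; inj₁; inj₂; swap)
open import Data.Vec using (Vec; tabulate)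
import Data.Vec.Properties as Vec
open import Function.Definitions using (Injective; StrictlySurjective)
open import Level using (0ℓ)
open import Relation.Binary.Core using (Rel)
open import Relation.Binary.Definitions
  using (Decidable; DecidableEquality; Symmetric; Irreflexive)
open import Relation.Binary.Construct.Closure.ReflexiveTransitive using (Star)
open import Relation.Binary.PropositionalEquality
  using (_≡_; _≢_; refl; sym; trans; cong; ≢-sym)
open import Relation.Nullary using (¬_; Dec; yes; no; does)
open import Relation.Nullary.Decidable using (map′; ¬?; _×-dec_; _⊎-dec_; _→-dec_)
open import Relation.Unary using (Pred)

record Graph (n : ℕ) : Set₁ where
  field
    Adj        : Rel (Fin n) 0ℓ
    adj?       : Decidable Adj
    adj-sym    : Symmetric Adj
    adj-irrefl : Irreflexive _≡_ Adj

open Graph public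

degree : ∀ {n} → Graph n → Fin n → ℕ
degree G v = ∣ tabulate (λ u → does (adj? G v u)) ∣

Regular : ∀ {n} → Graph n → Set
Regular G = ∃[ d ] ∀ v → degree G v ≡ d

Bipartite : ∀ {n} → Graph n → Set
Bipartite {n} G =
  Σ (Fin n → Bool) λ side → ∀ u v → Adj G u v → side u ≢ side v

Connected : ∀ {n} → Graph n → Set
Connected G = ∀ u v → Star (Adj G) u v

-- G is obtained from B by deleting edges (possibly none).
_⊆ᴱ_ : ∀ {n} → Graph n → Graph n → Set
G ⊆ᴱ B = ∀ u v → Adj G u v → Adj B u v

IsEmbedding : ∀ {h n} → Graph h → Graph n → (Fin h → Fin n) → Set
IsEmbedding H G f =
  Injective _≡_ _≡_ f × (∀ x y → Adj H x y → Adj G (f x) (f y))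

isEmbedding? : ∀ {h n} (H : Graph h) (G : Graph n) f → Dec (IsEmbedding H G f)
isEmbedding? H G f =
  map′ (λ i {x} {y} → i x y) (λ i x y → i {x} {y})
    (all? λ x → all? λ y → (f x ≟ f y) →-dec (x ≟ y))
  ×-dec
  all? λ x → all? λ y → adj? H x y →-dec adj? G (f x) (f y)

_-Free_ : ∀ {h n} → Graph h → Graph n → Set
F -Free G = ¬ ∃ (IsEmbedding F G)

-- A subgraph of a graph on Fin n, as its vertex set and its adjacency matrix.
-- The vertex set is kept because H may have isolated vertices.
Subgraph : ℕ → Set
Subgraph n = Subset n × Vec (Subset n) n

_≟ˢ_ : ∀ {n} → DecidableEquality (Subgraph n)
_≟ˢ_ = ≡-dec (Vec.≡-dec Bool._≟_) (Vec.≡-dec (Vec.≡-dec Bool._≟_))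

image : ∀ {h n} → Graph h → (Fin h → Fin n) → Subgraph n
image H f =
  tabulate (λ v → does (any? λ x → f x ≟ v)) ,
  tabulate (λ u → tabulate λ v → does
    (any? λ x → any? λ y → adj? H x y ×-dec (f x ≟ u) ×-dec (f y ≟ v)))

-- The copies of H in G are the subgraphs of G isomorphic to H, that is, the
-- images of the embeddings of H; embeddings with the same image (differing by
-- an automorphism of H) are identified by deduplication.  finToFun enumerates
-- all functions Fin h → Fin n.
copies : ∀ {h n} → Graph h → Graph n → List (Subgraph n)
copies {h} {n} H G =
  deduplicate _≟ˢ_
    (map (image H)
      (filter (isEmbedding? H G)
        (map finToFun (allFin (n ^ h)))))

𝒩 : ∀ {h n} → Graph h → Graph n → ℕ
𝒩 H G = length (copies H G)

K : ∀ n → Graph n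
K n = record
  { Adj        = _≢_
  ; adj?       = λ u v → ¬? (u ≟ v)
  ; adj-sym    = ≢-sym
  ; adj-irrefl = λ p q → q p
  }

-- The parts are the first ⌊ n /2⌋ vertices and the remaining ⌈ n /2⌉ ones.
T₂ : ∀ n → Graph n
T₂ n = record
  { Adj        = λ u v → side u ≢ side v
  ; adj?       = λ u v → ¬? (side u Bool.≟ side v)
  ; adj-sym    = ≢-sym
  ; adj-irrefl = λ p q → q (cong side p)
  }
  where
  side : Fin n → Bool
  side v = does (toℕ v <? ⌊ n /2⌋)

-- Cycle k is the cycle on k + 3 vertices.
Cycle : ∀ k → Graph (3 + k)
Cycle k = record
  { Adj        = λ u v → Next u v ⊎ Next v u
  ; adj?       = λ u v → next? u v ⊎-dec next? v u
  ; adj-sym    = swap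
  ; adj-irrefl = λ { {u} refl (inj₁ p) → next-irrefl u p
                   ; {u} refl (inj₂ p) → next-irrefl u p }
  }
  where
  Next : Rel (Fin (3 + k)) 0ℓ
  Next u v = toℕ v ≡ suc (toℕ u) % (3 + k)

  next? : Decidable Next
  next? u v = toℕ v ℕ.≟ suc (toℕ u) % (3 + k)

  next-irrefl : ∀ u → ¬ Next u u
  next-irrefl u p with suc (toℕ u) <? 3 + k
  ... | yes l = m≢1+m+n (toℕ u)
                  (trans p (trans (m<n⇒m%n≡m l)
                    (cong suc (sym (+-identityʳ (toℕ u))))))
  ... | no ¬l = absurd (trans p (trans (cong (_% (3 + k)) e) (n%n≡0 (3 + k)))) e
    where
    e : suc (toℕ u) ≡ 3 + k
    e = ≤-antisym (toℕ<n u) (≮⇒≥ ¬l)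

    absurd : ∀ {m} → m ≡ 0 → suc m ≢ 3 + k
    absurd refl ()

C₅ : Graph 5
C₅ = Cycle 2

Acyclic : ∀ {n} → Graph n → Set
Acyclic G = ∀ k → Cycle k -Free G

IsTree : ∀ {n} → Graph n → Set
IsTree {n} G = NonZero n × Connected G × Acyclic G

-- The blow-up of Q in which vertex q is replaced by the independent set of
-- all v with part v ≡ q.
blowUp : ∀ {q n} → Graph q → (Fin n → Fin q) → Graph n
blowUp Q part = record
  { Adj        = λ u v → Adj Q (part u) (part v)
  ; adj?       = λ u v → adj? Q (part u) (part v)
  ; adj-sym    = adj-sym Q
  ; adj-irrefl = λ p → adj-irrefl Q (cong part p)
  }

-- Every vertex of Q is replaced by a nonempty set.
DeletedBlowUp : ∀ {q n} → Graph q → Graph n → Set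
DeletedBlowUp {q} {n} Q G =
  Σ (Fin n → Fin q) λ part →
    StrictlySurjective _≡_ part × G ⊆ᴱ blowUp Q part

IsMaximum : ∀ {ℓ} → Pred ℕ ℓ → ℕ → Set ℓ
IsMaximum P m = P m × (∀ k → P k → k ≤ m)

-- IsRex n H F m states that rex(n,H,F) = m.  It is a relation because the
-- maximum need not exist (no graph on n vertices may qualify).
IsRex : ∀ {h f} → (n : ℕ) → Graph h → Graph f → ℕ → Set₁
IsRex n H F m =
  IsMaximum (λ k → Σ (Graph n) λ G → F -Free G × Regular G × 𝒩 H G ≡ k) m

{-# OPTIONS --safe #-}
module Submission where

-- All copies of H have the same number of embeddings with that image, so it
-- suffices to compare numbers of embeddings.  Embed H one vertex at a time, each
-- vertex next to an earlier neighbour if it has one.  In a d-regular graph such a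
-- step has at most d choices; in a d′-regular graph G′ it has at least d′ − h
-- choices if H is a forest, or if H is bipartite and G′ is balanced complete
-- bipartite.  Hence G has at most as many copies as G′ if d ≤ d′ − h.
--
-- A d-regular triangle-free graph with 3d > n is bipartite or contains a C₅, and
-- the latter forces 5d ≤ 2n.  So for even n the remaining graphs are balanced
-- bipartite and lie in T₂ n.  For odd n a regular graph of positive degree is not
-- bipartite.  There is an explicit (2m)-regular deleted blow-up of C₅ on
-- n = 5m + 2j vertices, j ≤ 4, so only 2n − 5d = O(h) remains, and then almost all
-- vertices have two neighbours on the C₅.  This splits the graph into five classes
-- whose adjacencies are those of C₅.

open import Defs
import Algebra.Properties.CommutativeMonoid.Sum
import Algebra.Properties.Monoid.Sum
open import Data.Bool using (Bool; true; false; _∨_; _xor_)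
import Data.Bool.Properties as Bool
open import Data.Empty using (⊥; ⊥-elim)
open import Data.Fin 
  using (Fin; zero; suc; toℕ; fromℕ; fromℕ<; inject₁; _↑ˡ_; _↑ʳ_; splitAt; combine; remQuot; finToFun; funToFin; _≟_)
import Data.Fin as Fin
open import Data.Fin.Properties using (all?; any?)
import Data.Fin.Properties as Fin
open import Data.Fin.Subset using (∣_∣)
open import Data.List using (List; []; _∷_; length; map; concatMap; filter; deduplicate; allFin)
import Data.List as List
import Data.List.Properties as List
open import Data.List.Membership.Propositional using (_∈_; find)
open import Data.List.Membership.Propositional.Properties
open import Data.List.Relation.Unary.All as All using (All; []; _∷_)
open import Data.List.Relation.Unary.All.Properties using (¬Any⇒All¬)
open import Data.List.Relation.Unary.AllPairs using ([]; _∷_)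
open import Data.List.Relation.Unary.Any as Any using (Any; here; there; index)
open import Data.List.Relation.Unary.Any.Properties using (lookup-index)
open import Data.List.Relation.Unary.Unique.Propositional using (Unique)
import Data.List.Relation.Unary.Unique.Propositional.Properties as Unique
open import Data.List.Relation.Unary.Unique.DecPropositional.Properties using (deduplicate-!)
open import Data.Maybe using (Maybe; just; nothing)
import Data.Maybe.Properties as Maybe
open import Data.Nat
  using (ℕ; zero; suc; _+_; _*_; _^_; _∸_; _≤_; _<_; _≤?_; _<?_; ⌊_/2⌋; z≤n; s≤s; NonZero; >-nonZero)
open import Data.Nat.Divisibility using (_∣_; _∤_; divides)
open import Data.Nat.DivMod using (_%_; %-distribˡ-+; m<n⇒m%n≡m; n%n≡0; m%n%n≡m%n)
open import Data.Nat.Properties hiding (_≟_; _≤?_; _<?_; suc-injective)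
import Data.Nat.Properties as ℕ
open import Data.Nat.Solver using (module +-*-Solver)
open import Data.Product using (Σ; ∃; ∃-syntax; ∃₂; _×_; _,_; proj₁; proj₂; uncurry)
open import Data.Sum using (_⊎_; inj₁; inj₂)
import Data.Sum as Sum
open import Data.Unit using (⊤; tt)
open import Data.Vec using (Vec; []; _∷_; lookup; tabulate)
import Data.Vec as Vec
import Data.Vec.Properties as Vec
open import Function using (_∘_; id; mk⇔)
open import Function.Definitions using (StrictlySurjective)
open import Level using (Level; 0ℓ)
open import Relation.Binary.Construct.Closure.ReflexiveTransitive as Star using (Star; ε; _◅_; _◅◅_)
open import Relation.Binary.Definitions using (DecidableEquality; tri<; tri≈; tri>)
open import Relation.Binary.PropositionalEquality
open import Relation.Nullary using (¬_; Dec; yes; no; does; contradiction)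
open import Relation.Nullary.Decidable
  using (does-⇔; dec-true; dec-false; decidable-stable; toWitness; ¬?; _×-dec_; _⊎-dec_; _→-dec_)
open import Relation.Unary using (Pred; Decidable)

open Algebra.Properties.CommutativeMonoid.Sum +-0-commutativeMonoid using (sum; ∑-distrib-+; ∑-comm; sum-cong-≗)
open Algebra.Properties.Monoid.Sum +-0-monoid using (sum-init-last)
open +-*-Solver using (solve; _:+_; _:*_; _:=_; con)

-- Degrees are compared only up to the additive loss h, so copies are never counted exactly; the
-- price is that degrees within h of the reference degree need a structural argument. In that range
-- 5d > 2n for even n, which excludes a C₅, and 2n - 5d is at most a constant for odd n. Both
-- thresholds on n are therefore linear in h.
--
-- H must be a forest for odd n because G′ is then not complete between its classes: a new vertex
-- with two earlier neighbours would need common neighbours of their images. In T₂ vertices on one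
-- side have the same neighbourhood, so cycles in H do no harm.
--
-- The graph G* is not determined. For odd n a maximiser G exists; either its degree is large and G
-- itself is a deleted blow-up, or the explicit graph has at least as many copies and is a maximiser
-- too.
--
-- The five classes cannot be read off from adjacency to the C₅, since exceptional vertices need a
-- class as well. A vertex w gets an index i for which the neighbourhood of w nearly equals that of
-- `c i`. By regularity neighbourhoods have equal size, so a small difference on one side is a small
-- difference on the other.

private variable
  n h k   : ℕ
  a p q r : Level
  A B     : Set a

-- Counting

⟦_⟧ : {A : Set a} → Dec A → ℕ
⟦ yes _ ⟧ = 1
⟦ no _ ⟧  = 0

# : {P : Pred (Fin n) p} → Decidable P → ℕ
# P? = sum (λ i → ⟦ P? i ⟧)

⟦⟧-mono : (A → B) → (x : Dec A) (y : Dec B) → ⟦ x ⟧ ≤ ⟦ y ⟧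
⟦⟧-mono f (no _)  _       = z≤n
⟦⟧-mono f (yes _) (yes _) = ≤-refl
⟦⟧-mono f (yes x) (no ¬y) = contradiction (f x) ¬y

⟦⟧-cong : (A → B) → (B → A) → (x : Dec A) (y : Dec B) → ⟦ x ⟧ ≡ ⟦ y ⟧
⟦⟧-cong f g x y = ≤-antisym (⟦⟧-mono f x y) (⟦⟧-mono g y x)

⟦⟧-≤1 : {A : Set a} (x : Dec A) → ⟦ x ⟧ ≤ 1
⟦⟧-≤1 (yes _) = ≤-refl
⟦⟧-≤1 (no _)  = z≤n

⟦⟧-true : {A : Set a} (x : Dec A) → A → ⟦ x ⟧ ≡ 1
⟦⟧-true (yes _) _ = refl
⟦⟧-true (no ¬x) x = contradiction x ¬x

⟦⟧-false : {A : Set a} (x : Dec A) → ¬ A → ⟦ x ⟧ ≡ 0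
⟦⟧-false (no _)  _  = refl
⟦⟧-false (yes x) ¬x = contradiction x ¬x

sum-mono : {f g : Fin n → ℕ} → (∀ i → f i ≤ g i) → sum f ≤ sum g
sum-mono {zero}  _   = z≤n
sum-mono {suc n} f≤g = +-mono-≤ (f≤g zero) (sum-mono (f≤g ∘ suc))

sum-const : ∀ n c → sum {n} (λ _ → c) ≡ n * c
sum-const zero    c = refl
sum-const (suc n) c = cong (c +_) (sum-const n c)

sum-*ʳ : ∀ (f : Fin n → ℕ) c → sum (λ i → f i * c) ≡ sum f * c
sum-*ʳ {zero}  f c = refl
sum-*ʳ {suc n} f c =
  trans (cong (f zero * c +_) (sum-*ʳ (f ∘ suc) c)) (sym (*-distribʳ-+ c (f zero) _))

#-mono : {P : Pred (Fin n) p} {Q : Pred (Fin n) q} (P? : Decidable P) (Q? : Decidable Q) →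
         (∀ i → P i → Q i) → # P? ≤ # Q?
#-mono P? Q? f = sum-mono λ i → ⟦⟧-mono (f i) (P? i) (Q? i)

#-cong : {P : Pred (Fin n) p} {Q : Pred (Fin n) q} (P? : Decidable P) (Q? : Decidable Q) →
         (∀ i → P i → Q i) → (∀ i → Q i → P i) → # P? ≡ # Q?
#-cong P? Q? f g = ≤-antisym (#-mono P? Q? f) (#-mono Q? P? g)

#-zero : {P : Pred (Fin n) p} (P? : Decidable P) → (∀ i → ¬ P i) → # P? ≡ 0
#-zero {n} P? ¬P = trans (sum-cong-≗ λ i → ⟦⟧-false (P? i) (¬P i)) (trans (sum-const n 0) (*-zeroʳ n))

#-full : {P : Pred (Fin n) p} (P? : Decidable P) → (∀ i → P i) → # P? ≡ n
#-full {n} P? allP = trans (sum-cong-≗ λ i → ⟦⟧-true (P? i) (allP i)) (trans (sum-const n 1) (*-identityʳ n))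

#-⊎ : {P : Pred (Fin n) p} {Q : Pred (Fin n) q} {R : Pred (Fin n) r}
  (P? : Decidable P) (Q? : Decidable Q) (R? : Decidable R) → (∀ i → P i → Q i ⊎ R i) → # P? ≤ # Q? + # R?
#-⊎ P? Q? R? P⇒Q⊎R = ≤-trans (sum-mono pointwise) (≤-reflexive (∑-distrib-+ (λ i → ⟦ Q? i ⟧) λ i → ⟦ R? i ⟧))
  where
  pointwise : ∀ i → ⟦ P? i ⟧ ≤ ⟦ Q? i ⟧ + ⟦ R? i ⟧
  pointwise i with P? i
  ... | no _ = z≤n
  ... | yes x with P⇒Q⊎R i x
  ...   | inj₁ y = ≤-trans (≤-reflexive (sym (⟦⟧-true (Q? i) y))) (m≤m+n _ _)
  ...   | inj₂ z = ≤-trans (≤-reflexive (sym (⟦⟧-true (R? i) z))) (m≤n+m _ _)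

#-split : {P : Pred (Fin n) p} {Q : Pred (Fin n) q} (P? : Decidable P) (Q? : Decidable Q) →
  # P? ≡ # (λ i → P? i ×-dec Q? i) + # (λ i → P? i ×-dec ¬? (Q? i))
#-split P? Q? = trans (sum-cong-≗ pointwise)
  (∑-distrib-+ (λ i → ⟦ P? i ×-dec Q? i ⟧) λ i → ⟦ P? i ×-dec ¬? (Q? i) ⟧)
  where
  pointwise : ∀ i → ⟦ P? i ⟧ ≡ ⟦ P? i ×-dec Q? i ⟧ + ⟦ P? i ×-dec ¬? (Q? i) ⟧
  pointwise i with P? i | Q? i
  ... | yes _ | yes _ = refl
  ... | yes _ | no _  = refl
  ... | no _  | yes _ = refl
  ... | no _  | no _  = refl

#-≟ : (v : Fin n) → # (λ u → u ≟ v) ≡ 1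
#-≟ {suc n} zero =
  cong suc (trans (sum-cong-≗ {n} {λ i → ⟦ suc i ≟ zero ⟧} {λ _ → 0} λ _ → refl)
                  (trans (sum-const n 0) (*-zeroʳ n)))
#-≟ {suc n} (suc v) =
  trans (sum-cong-≗ λ i → ⟦⟧-cong Fin.suc-injective (cong suc) (suc i ≟ suc v) (i ≟ v)) (#-≟ v)

#-mono-< : {P : Pred (Fin n) p} {Q : Pred (Fin n) q} (P? : Decidable P) (Q? : Decidable Q) →
  (∀ i → P i → Q i) → ∀ j → Q j → ¬ P j → # P? < # Q?
#-mono-< P? Q? P⇒Q j qj ¬pj = begin
  suc (# P?)                                ≡⟨ cong (_+ # P?) (sym (#-≟ j)) ⟩
  # (_≟ j) + # P?                           ≡⟨ sym (∑-distrib-+ (λ i → ⟦ i ≟ j ⟧) (λ i → ⟦ P? i ⟧)) ⟩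
  sum (λ i → ⟦ i ≟ j ⟧ + ⟦ P? i ⟧)          ≤⟨ sum-mono pointwise ⟩
  # Q?                                      ∎
  where
  open ≤-Reasoning
  pointwise : ∀ i → ⟦ i ≟ j ⟧ + ⟦ P? i ⟧ ≤ ⟦ Q? i ⟧
  pointwise i with i ≟ j
  ... | yes refl = ≤-reflexive (trans (cong suc (⟦⟧-false (P? i) ¬pj)) (sym (⟦⟧-true (Q? i) qj)))
  ... | no _     = ⟦⟧-mono (P⇒Q i) (P? i) (Q? i)

∣tabulate∣≡# : {P : Pred (Fin n) p} (P? : Decidable P) → ∣ tabulate (λ i → does (P? i)) ∣ ≡ # P?
∣tabulate∣≡# {zero}  P? = refl
∣tabulate∣≡# {suc n} P? with P? zero
... | yes _ = cong suc (∣tabulate∣≡# (P? ∘ suc))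
... | no _  = ∣tabulate∣≡# (P? ∘ suc)

degree≡# : (G : Graph n) (v : Fin n) → degree G v ≡ # (adj? G v)
degree≡# G v = ∣tabulate∣≡# (adj? G v)

length-filter-tabulate : {P : Pred A p} (P? : Decidable P) (f : Fin n → A) →
  length (filter P? (List.tabulate f)) ≡ sum (λ i → ⟦ P? (f i) ⟧)
length-filter-tabulate {n = zero}  P? f = refl
length-filter-tabulate {n = suc n} P? f with P? (f zero)
... | yes _ = cong suc (length-filter-tabulate P? (f ∘ suc))
... | no _  = length-filter-tabulate P? (f ∘ suc)

length-filter-map : {P : Pred B p} (P? : Decidable P) (f : A → B) (xs : List A) →
  length (filter P? (map f xs)) ≡ length (filter (P? ∘ f) xs)
length-filter-map P? f []       = refl
length-filter-map P? f (x ∷ xs) with does (P? (f x))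
... | true  = cong suc (length-filter-map P? f xs)
... | false = length-filter-map P? f xs

filter-map : {P : Pred B p} (P? : Decidable P) (f : A → B) (xs : List A) →
  filter P? (map f xs) ≡ map f (filter (P? ∘ f) xs)
filter-map P? f []       = refl
filter-map P? f (x ∷ xs) with does (P? (f x))
... | true  = cong (f x ∷_) (filter-map P? f xs)
... | false = filter-map P? f xs

lookup-injective : {xs : List A} → Unique xs → ∀ {i j} → List.lookup xs i ≡ List.lookup xs j → i ≡ j
lookup-injective (_ ∷ _) {zero}  {zero}  _ = refl
lookup-injective (x∉ ∷ _) {zero} {suc j} e = contradiction e (All.lookup x∉ (∈-lookup j))
lookup-injective (x∉ ∷ _) {suc i} {zero} e = contradiction (sym e) (All.lookup x∉ (∈-lookup i))
lookup-injective (_ ∷ u) {suc i} {suc j} e = cong suc (lookup-injective u e)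

-- Pigeonhole on positions. Injectivity is asked only on the members of `xs`, because the maps
-- between lists of embeddings are injective only there.
length-≤-injection : {xs : List A} {ys : List B} (f : A → B) → Unique xs →
  (∀ {x} → x ∈ xs → f x ∈ ys) →
  (∀ {x x′} → x ∈ xs → x′ ∈ xs → f x ≡ f x′ → x ≡ x′) →
  length xs ≤ length ys
length-≤-injection {xs = xs} {ys} f uniq f∈ f-inj =
  Fin.injective⇒≤ {f = λ i → index (f∈ (∈-lookup {xs = xs} i))} λ {i} {j} e →
    lookup-injective uniq (f-inj (∈-lookup i) (∈-lookup j)
      (trans (lookup-index (f∈ (∈-lookup i)))
        (trans (cong (List.lookup ys) e) (sym (lookup-index (f∈ (∈-lookup j)))))))

module _ {A : Set a} (_≈?_ : DecidableEquality A) where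

  occurrences : A → List A → ℕ
  occurrences x xs = length (filter (x ≈?_) xs)

  sumOver : List A → (A → ℕ) → ℕ
  sumOver []       f = 0
  sumOver (x ∷ xs) f = f x + sumOver xs f

  private
    sumOver-const : ∀ {c f} ys → (∀ {y} → y ∈ ys → f y ≡ c) → sumOver ys f ≡ length ys * c
    sumOver-const []       _ = refl
    sumOver-const (y ∷ ys) e = cong₂ _+_ (e (here refl)) (sumOver-const ys (e ∘ there))

    sumOver-occurrences-∉ : ∀ {x} xs ys → All (x ≢_) ys →
      sumOver ys (λ y → occurrences y (x ∷ xs)) ≡ sumOver ys (λ y → occurrences y xs)
    sumOver-occurrences-∉ xs []       _ = refl
    sumOver-occurrences-∉ {x} xs (y ∷ ys) (x≢y ∷ x∉) with y ≈? x
    ... | yes y≡x = contradiction (sym y≡x) x≢y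
    ... | no _    = cong (occurrences y xs +_) (sumOver-occurrences-∉ xs ys x∉)

    sumOver-occurrences-∈ : ∀ {x} xs ys → Unique ys → x ∈ ys →
      sumOver ys (λ y → occurrences y (x ∷ xs)) ≡ suc (sumOver ys (λ y → occurrences y xs))
    sumOver-occurrences-∈ {x} xs (y ∷ ys) (y∉ ∷ u) x∈ with y ≈? x
    ... | yes refl = cong (λ s → suc (occurrences x xs + s)) (sumOver-occurrences-∉ xs ys y∉)
    ... | no y≢x =
      trans (cong (occurrences y xs +_)
              (sumOver-occurrences-∈ xs ys u (Any.tail (y≢x ∘ sym) x∈)))
            (+-suc _ _)

    length≡sumOver-occurrences : ∀ xs ys → Unique ys → (∀ {x} → x ∈ xs → x ∈ ys) →
      length xs ≡ sumOver ys (λ y → occurrences y xs)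
    length≡sumOver-occurrences []       ys u _ = sym (trans (sumOver-const ys λ _ → refl) (*-zeroʳ (length ys)))
    length≡sumOver-occurrences (x ∷ xs) ys u ⊆ys =
      trans (cong suc (length≡sumOver-occurrences xs ys u (⊆ys ∘ there)))
            (sym (sumOver-occurrences-∈ xs ys u (⊆ys (here refl))))

  -- Double counting: the length is the sum of the multiplicities of the distinct entries.
  length-deduplicate-* : ∀ c xs → (∀ {x} → x ∈ xs → occurrences x xs ≡ c) →
    length xs ≡ length (deduplicate _≈?_ xs) * c
  length-deduplicate-* c xs e =
    trans (length≡sumOver-occurrences xs (deduplicate _≈?_ xs) (deduplicate-! _≈?_ xs) (∈-deduplicate⁺ _≈?_))
          (sumOver-const (deduplicate _≈?_ xs) (e ∘ ∈-deduplicate⁻ _≈?_ xs))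

-- Copies and embeddings

funToFin-cong : {f g : Fin k → Fin n} → f ≗ g → funToFin f ≡ funToFin g
funToFin-cong {zero}  e = refl
funToFin-cong {suc k} e = cong₂ combine (e zero) (funToFin-cong (e ∘ suc))

finToFun-injective : {i j : Fin (n ^ k)} → finToFun {n} {k} i ≗ finToFun j → i ≡ j
finToFun-injective {n} {k} {i} {j} e =
  trans (sym (Fin.funToFin-finToFin {k} i)) (trans (funToFin-cong {k} e) (Fin.funToFin-finToFin {k} j))

module _ (H : Graph h) where

  infix 4 _⊑_

  -- f ⊑ g: the image of H under f is a subgraph of its image under g.
  _⊑_ : (f g : Fin h → Fin n) → Set
  f ⊑ g = (∀ x → ∃ λ y → g y ≡ f x) ×
          (∀ x y → Adj H x y → ∃₂ λ x′ y′ → Adj H x′ y′ × g x′ ≡ f x × g y′ ≡ f y)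

  private
    vertex? : (f : Fin h → Fin n) (v : Fin n) → Dec (∃ λ x → f x ≡ v)
    vertex? f v = any? λ x → f x ≟ v

    edge? : (f : Fin h → Fin n) (u v : Fin n) → Dec (∃₂ λ x y → Adj H x y × f x ≡ u × f y ≡ v)
    edge? f u v = any? λ x → any? λ y → adj? H x y ×-dec (f x ≟ u) ×-dec (f y ≟ v)

    tabulate-≗ : ∀ {A : Set} {p q : Fin n → A} → tabulate p ≡ tabulate q → p ≗ q
    tabulate-≗ {p = p} {q} e i = trans (sym (Vec.lookup∘tabulate p i))
      (trans (cong (λ v → lookup v i) e) (Vec.lookup∘tabulate q i))

    does-≡⇒ : ∀ {P Q : Set} (P? : Dec P) (Q? : Dec Q) → does P? ≡ does Q? → P → Q
    does-≡⇒ (yes _) (yes q) _  _ = q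
    does-≡⇒ (no ¬p) _       _  p = contradiction p ¬p
    does-≡⇒ (yes _) (no _)  ()

  image-⊑ : {f g : Fin h → Fin n} → image H f ≡ image H g → f ⊑ g
  image-⊑ {f = f} {g} e = verts , edges
    where
    verts : ∀ x → ∃ λ y → g y ≡ f x
    verts x = does-≡⇒ (vertex? f (f x)) (vertex? g (f x)) (tabulate-≗ (cong proj₁ e) (f x)) (x , refl)

    edges : ∀ x y → Adj H x y → ∃₂ λ x′ y′ → Adj H x′ y′ × g x′ ≡ f x × g y′ ≡ f y
    edges x y a = does-≡⇒ (edge? f (f x) (f y)) (edge? g (f x) (f y))
      (tabulate-≗ (tabulate-≗ (cong proj₂ e) (f x)) (f y)) (x , y , a , refl , refl)

  ⊑-image : {f g : Fin h → Fin n} → f ⊑ g → g ⊑ f → image H f ≡ image H g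
  ⊑-image {f = f} {g} (v , e) (v′ , e′) = cong₂ _,_
    (Vec.tabulate-cong λ w → does-⇔ (mk⇔ (λ { (x , refl) → v x }) (λ { (x , refl) → v′ x })) (vertex? f w) (vertex? g w))
    (Vec.tabulate-cong λ u → Vec.tabulate-cong λ w → does-⇔
      (mk⇔ (λ { (x , y , a , refl , refl) → e x y a }) (λ { (x , y , a , refl , refl) → e′ x y a }))
      (edge? f u w) (edge? g u w))

  ⊑-resp-≗ : {f f′ g g′ : Fin h → Fin n} → f ≗ f′ → g ≗ g′ → f ⊑ g → f′ ⊑ g′
  ⊑-resp-≗ p q (v , e) =
    (λ x → let y , r = v x in y , trans (sym (q y)) (trans r (p x))) ,
    (λ x y a → let x′ , y′ , a′ , r , s = e x y a in
      x′ , y′ , a′ , trans (sym (q x′)) (trans r (p x)) , trans (sym (q y′)) (trans s (p y)))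

  isEmbedding-resp-≗ : (G : Graph n) {f g : Fin h → Fin n} → f ≗ g → IsEmbedding H G f → IsEmbedding H G g
  isEmbedding-resp-≗ G p (inj , hom) =
    (λ {x} {y} e → inj (trans (p x) (trans e (sym (p y))))) ,
    (λ x y a → subst₂ (Adj G) (p x) (p y) (hom x y a))

  -- Codes take the place of functions: two codes that agree pointwise are equal, which makes
  -- uniqueness of list entries usable without function extensionality.
  embeddings : Graph n → List (Fin (n ^ h))
  embeddings G = filter (λ i → isEmbedding? H G (finToFun i)) (allFin _)

  embeddings-unique : (G : Graph n) → Unique (embeddings G)
  embeddings-unique G = Unique.filter⁺ _ (Unique.tabulate⁺ id)

  ∈-embeddings⁻ : (G : Graph n) {i : Fin (n ^ h)} → i ∈ embeddings G → IsEmbedding H G (finToFun i)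
  ∈-embeddings⁻ G = proj₂ ∘ ∈-filter⁻ (λ i → isEmbedding? H G (finToFun i)) {xs = allFin _}

  ∈-embeddings⁺ : (G : Graph n) {f : Fin h → Fin n} → IsEmbedding H G f → funToFin f ∈ embeddings G
  ∈-embeddings⁺ G {f} emb = ∈-filter⁺ (λ i → isEmbedding? H G (finToFun i)) (∈-allFin _)
    (isEmbedding-resp-≗ G (sym ∘ Fin.finToFun-funToFin f) emb)

  images : Graph n → List (Subgraph n)
  images G = map (image H ∘ finToFun) (embeddings G)

  copies≡ : (G : Graph n) → copies H G ≡ deduplicate _≟ˢ_ (images G)
  copies≡ {n} G = cong (deduplicate _≟ˢ_)
    (trans (cong (map (image H)) (filter-map (isEmbedding? H G) finToFun (allFin (n ^ h))))
           (sym (List.map-∘ (embeddings G))))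

  -- If g and g′ are embeddings, then f ↦ g′ ∘ g⁻¹ ∘ f maps the embeddings with
  -- the image of g to those with the image of g′.
  occurrences-images-≤ : (G G′ : Graph n) {S S′ : Subgraph n} → S ∈ images G → S′ ∈ images G′ →
    occurrences _≟ˢ_ S (images G) ≤ occurrences _≟ˢ_ S′ (images G′)
  occurrences-images-≤ {n} G G′ S∈ S′∈
    with j , j∈ , refl ← ∈-map⁻ (image H ∘ finToFun) S∈
       | j′ , j′∈ , refl ← ∈-map⁻ (image H ∘ finToFun) S′∈ =
    subst₂ _≤_ (sym (length-filter-map (S ≟ˢ_) im (embeddings G)))
               (sym (length-filter-map (S′ ≟ˢ_) im (embeddings G′)))
      (length-≤-injection φ (Unique.filter⁺ _ (embeddings-unique G)) φ-∈ φ-injective)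
    where
    im : Fin (n ^ h) → Subgraph n
    im = image H ∘ finToFun
    S  = im j
    S′ = im j′

    g g′ : Fin h → Fin n
    g  = finToFun j
    g′ = finToFun j′

    g-inj  = proj₁ (∈-embeddings⁻ G j∈)
    g′-inj = proj₁ (∈-embeddings⁻ G′ j′∈)

    σ : Fin (n ^ h) → Fin h → Fin h
    σ i x with any? (λ y → g y ≟ finToFun i x)
    ... | yes (y , _) = y
    -- A default value; it is not reached when the image of `finToFun i` lies in that of `g`.
    ... | no _        = x

    g∘σ : ∀ i → finToFun i ⊑ g → g ∘ σ i ≗ finToFun i
    g∘σ i (v , _) x with any? (λ y → g y ≟ finToFun i x)
    ... | yes (_ , e) = e
    ... | no ¬e       = contradiction (v x) ¬e

    φ : Fin (n ^ h) → Fin (n ^ h)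
    φ i = funToFin (g′ ∘ σ i)

    xs  = filter (λ i → S ≟ˢ im i) (embeddings G)
    xs′ = filter (λ i → S′ ≟ˢ im i) (embeddings G′)

    member : ∀ {i} → i ∈ xs → i ∈ embeddings G × S ≡ im i
    member = ∈-filter⁻ (λ i → S ≟ˢ im i) {xs = embeddings G}

    eq : ∀ {i} → i ∈ xs → g ∘ σ i ≗ finToFun i
    eq {i} i∈ = g∘σ i (image-⊑ (sym (proj₂ (member i∈))))

    φ-∈ : ∀ {i} → i ∈ xs → φ i ∈ xs′
    φ-∈ {i} i∈ = ∈-filter⁺ (λ i → S′ ≟ˢ im i) (∈-embeddings⁺ G′ (inj , hom))
      (⊑-image (⊑-resp-≗ (λ _ → refl) (sym ∘ φ-eq) below)
               (⊑-resp-≗ (sym ∘ φ-eq) (λ _ → refl) above))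
      where
      f = finToFun {n} {h} i
      f⊑g = image-⊑ {f = f} {g} (sym (proj₂ (member i∈)))
      g⊑f = image-⊑ {f = g} {f} (proj₂ (member i∈))
      f-inj = proj₁ (∈-embeddings⁻ G (proj₁ (member i∈)))
      φ-eq = Fin.finToFun-funToFin (g′ ∘ σ i)

      σ-unique : ∀ {x y} → g y ≡ f x → σ i x ≡ y
      σ-unique {x} e = g-inj (trans (eq i∈ x) (sym e))

      inj : ∀ {x y} → g′ (σ i x) ≡ g′ (σ i y) → x ≡ y
      inj {x} {y} e = f-inj (trans (sym (eq i∈ x)) (trans (cong g (g′-inj e)) (eq i∈ y)))

      σ-hom : ∀ x y → Adj H x y → Adj H (σ i x) (σ i y)
      σ-hom x y a with x′ , y′ , a′ , e , e′ ← proj₂ f⊑g x y a =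
        subst₂ (Adj H) (sym (σ-unique e)) (sym (σ-unique e′)) a′

      hom : ∀ x y → Adj H x y → Adj G′ (g′ (σ i x)) (g′ (σ i y))
      hom x y a = proj₂ (∈-embeddings⁻ G′ j′∈) _ _ (σ-hom x y a)

      above : (g′ ∘ σ i) ⊑ g′
      above = (λ x → σ i x , refl) , (λ x y a → σ i x , σ i y , σ-hom x y a , refl , refl)

      below : g′ ⊑ (g′ ∘ σ i)
      below =
        (λ y → let x , e = proj₁ g⊑f y in x , cong g′ (σ-unique (sym e))) ,
        (λ x y a → let x′ , y′ , a′ , e , e′ = proj₂ g⊑f x y a in
          x′ , y′ , a′ , cong g′ (σ-unique (sym e)) , cong g′ (σ-unique (sym e′)))

    φ-injective : ∀ {i i′} → i ∈ xs → i′ ∈ xs → φ i ≡ φ i′ → i ≡ i′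
    φ-injective {i} {i′} i∈ i′∈ e = finToFun-injective {n} {h} λ x →
      trans (sym (eq i∈ x)) (trans (cong g (g′-inj (g′σ x))) (eq i′∈ x))
      where
      g′σ : ∀ x → g′ (σ i x) ≡ g′ (σ i′ x)
      g′σ x = trans (sym (Fin.finToFun-funToFin (g′ ∘ σ i) x))
        (trans (cong (λ c → finToFun c x) e) (Fin.finToFun-funToFin (g′ ∘ σ i′) x))

  -- Embeddings number `c` times the copies in both graphs, with the same `c`. Taking `c` from an
  -- actual copy `S` in `G` makes it positive, so it cancels; without a copy in `G` there is nothing
  -- to prove.
  𝒩-mono : (G G′ : Graph n) → length (embeddings G) ≤ length (embeddings G′) → 𝒩 H G ≤ 𝒩 H G′
  𝒩-mono G G′ emb≤ rewrite copies≡ G | copies≡ G′ = go (images G) refl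
    where
    go : ∀ xs → images G ≡ xs → length (deduplicate _≟ˢ_ xs) ≤ length (deduplicate _≟ˢ_ (images G′))
    go []       _ = z≤n
    go (S ∷ xs) e = *-cancelʳ-≤ _ _ c ⦃ nonZero ⦄ (begin
      length (deduplicate _≟ˢ_ (S ∷ xs)) * c ≡⟨ sym (length-deduplicate-* _≟ˢ_ c (S ∷ xs)
        (subst (λ ys → ∀ {T} → T ∈ ys → occurrences _≟ˢ_ T ys ≡ c) e (occ G))) ⟩
      length (S ∷ xs)                        ≡⟨ cong length (sym e) ⟩
      length (images G)                      ≡⟨ List.length-map _ (embeddings G) ⟩
      length (embeddings G)                  ≤⟨ emb≤ ⟩
      length (embeddings G′)                 ≡⟨ sym (List.length-map _ (embeddings G′)) ⟩
      length (images G′)                     ≡⟨ length-deduplicate-* _≟ˢ_ c (images G′) (occ G′) ⟩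
      length (deduplicate _≟ˢ_ (images G′)) * c ∎)
      where
      open ≤-Reasoning

      S∈ : S ∈ images G
      S∈ = subst (S ∈_) (sym e) (here refl)

      c = occurrences _≟ˢ_ S (images G)

      occ : ∀ G″ {T} → T ∈ images G″ → occurrences _≟ˢ_ T (images G″) ≡ c
      occ G″ T∈ = ≤-antisym (occurrences-images-≤ G″ G T∈ S∈) (occurrences-images-≤ G G″ S∈ T∈)

      nonZero : NonZero c
      nonZero = >-nonZero (nonempty (∈-filter⁺ (S ≟ˢ_) S∈ refl))
        where
        nonempty : ∀ {A : Set} {x : A} {ys} → x ∈ ys → 1 ≤ length ys
        nonempty (here _)  = s≤s z≤n
        nonempty (there _) = s≤s z≤n

  embeddings-mono : (G G′ : Graph n) (π : Fin n → Fin n) → IsEmbedding G G′ π →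
    length (embeddings G) ≤ length (embeddings G′)
  embeddings-mono {n} G G′ π (π-inj , π-hom) =
    length-≤-injection (λ i → funToFin {h} (π ∘ finToFun i)) (embeddings-unique G)
      (λ i∈ → let inj , hom = ∈-embeddings⁻ G i∈ in
        ∈-embeddings⁺ G′ ((λ e → inj (π-inj e)) , λ x y a → π-hom _ _ (hom x y a)))
      (λ {i} {j} _ _ e → finToFun-injective {n} {h} λ x → π-inj
        (trans (sym (Fin.finToFun-funToFin (π ∘ finToFun {n} {h} i) x))
          (trans (cong (λ c → finToFun {n} {h} c x) e) (Fin.finToFun-funToFin (π ∘ finToFun {n} {h} j) x))))

-- Embedding a graph vertex by vertex

Distinct : Vec A k → Set _
Distinct xs = ∀ i j → lookup xs i ≡ lookup xs j → i ≡ j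

_∉ᵛ_ : A → Vec A k → Set _
x ∉ᵛ xs = ∀ i → lookup xs i ≢ x

_∉ᵛ?_ : (x : Fin n) (xs : Vec (Fin n) k) → Dec (x ∉ᵛ xs)
x ∉ᵛ? xs = all? λ i → ¬? (lookup xs i ≟ x)

distinct-∷ : {x : A} {xs : Vec A k} → x ∉ᵛ xs → Distinct xs → Distinct (x ∷ xs)
distinct-∷ x∉ d zero zero _ = refl
distinct-∷ x∉ d zero (suc j) e = contradiction (sym e) (x∉ j)
distinct-∷ x∉ d (suc i) zero e = contradiction e (x∉ i)
distinct-∷ x∉ d (suc i) (suc j) e = cong suc (d i j e)

distinct-∷⁻ : {x : A} {xs : Vec A k} → Distinct (x ∷ xs) → x ∉ᵛ xs × Distinct xs
distinct-∷⁻ d = (λ i e → contradiction (d (suc i) zero e) λ ()) ,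
                (λ i j e → Fin.suc-injective (d (suc i) (suc j) e))

occurs : Vec (Fin n) k → Fin n → ℕ
occurs xs v = # (λ i → lookup xs i ≟ v)

-- Vertices on a vector are counted through multiplicities. These bound the indicator of membership
-- from above always, and equal it if the entries are distinct, which gives the two bounds on counts
-- avoiding `xs`.
sum-occurs : (xs : Vec (Fin n) k) → sum (occurs xs) ≡ k
sum-occurs {n} {k} xs = begin
  sum (λ v → sum λ i → ⟦ lookup xs i ≟ v ⟧) ≡⟨ ∑-comm (λ v i → ⟦ lookup xs i ≟ v ⟧) ⟩
  sum (λ i → sum λ v → ⟦ lookup xs i ≟ v ⟧) ≡⟨ sum-cong-≗ (λ i → trans
      (sum-cong-≗ λ v → ⟦⟧-cong sym sym (lookup xs i ≟ v) (v ≟ lookup xs i)) (#-≟ (lookup xs i))) ⟩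
  sum {k} (λ _ → 1)                         ≡⟨ sum-const k 1 ⟩
  k * 1                                     ≡⟨ *-identityʳ k ⟩
  k                                         ∎
  where open ≡-Reasoning

occurs-≥1 : (xs : Vec (Fin n) k) {v : Fin n} → ¬ v ∉ᵛ xs → 1 ≤ occurs xs v
occurs-≥1 []       ¬∉ = contradiction (λ ()) ¬∉
occurs-≥1 (x ∷ xs) {v} ¬∉ with x ≟ v
... | yes _  = s≤s z≤n
... | no x≢v = occurs-≥1 xs λ v∉ → ¬∉ λ { zero → x≢v ; (suc i) → v∉ i }

occurs-∉ : (xs : Vec (Fin n) k) {v : Fin n} → v ∉ᵛ xs → occurs xs v ≡ 0
occurs-∉ {k = k} xs {v} v∉ = trans (sum-cong-≗ λ i → ⟦⟧-false (lookup xs i ≟ v) (v∉ i))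
  (trans (sum-const k 0) (*-zeroʳ k))

occurs-≤1 : (xs : Vec (Fin n) k) → Distinct xs → ∀ v → occurs xs v ≤ 1
occurs-≤1 xs d v with any? (λ i → lookup xs i ≟ v)
... | yes (i , refl) = ≤-reflexive (trans (sum-cong-≗ λ j →
        ⟦⟧-cong (d j i) (cong (lookup xs)) (lookup xs j ≟ lookup xs i) (j ≟ i)) (#-≟ i))
... | no ¬∈ = subst (_≤ 1) (sym (occurs-∉ xs λ i e → ¬∈ (i , e))) z≤n

#-avoiding-≥ : {P : Pred (Fin n) p} {Q : Pred (Fin n) q} (P? : Decidable P) (Q? : Decidable Q)
  (xs : Vec (Fin n) k) → (∀ v → P v → v ∉ᵛ xs → Q v) → # P? ≤ # Q? + k
#-avoiding-≥ {n = n} {k = k} P? Q? xs P⇒Q = begin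
  # P?                                  ≤⟨ sum-mono pointwise ⟩
  sum (λ v → ⟦ Q? v ⟧ + occurs xs v)    ≡⟨ ∑-distrib-+ (λ v → ⟦ Q? v ⟧) (occurs xs) ⟩
  # Q? + sum (occurs xs)                ≡⟨ cong (# Q? +_) (sum-occurs xs) ⟩
  # Q? + k                              ∎
  where
  open ≤-Reasoning
  pointwise : ∀ v → ⟦ P? v ⟧ ≤ ⟦ Q? v ⟧ + occurs xs v
  pointwise v with v ∉ᵛ? xs
  ... | yes v∉ = ≤-trans (⟦⟧-mono (λ p → P⇒Q v p v∉) (P? v) (Q? v)) (m≤m+n _ _)
  ... | no ¬∉  = ≤-trans (⟦⟧-≤1 (P? v)) (≤-trans (occurs-≥1 xs ¬∉) (m≤n+m _ _))

#-avoiding-≤ : {Q : Pred (Fin n) q} (Q? : Decidable Q)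
  (xs : Vec (Fin n) k) → Distinct xs → (∀ v → Q v → v ∉ᵛ xs) → # Q? + k ≤ n
#-avoiding-≤ {n = n} {k = k} Q? xs d Q⇒∉ = begin
  # Q? + k                              ≡⟨ cong (# Q? +_) (sym (sum-occurs xs)) ⟩
  # Q? + sum (occurs xs)                ≡⟨ sym (∑-distrib-+ (λ v → ⟦ Q? v ⟧) (occurs xs)) ⟩
  sum (λ v → ⟦ Q? v ⟧ + occurs xs v)    ≤⟨ sum-mono pointwise ⟩
  sum {n} (λ _ → 1)                     ≡⟨ trans (sum-const n 1) (*-identityʳ n) ⟩
  n                                     ∎
  where
  open ≤-Reasoning
  pointwise : ∀ v → ⟦ Q? v ⟧ + occurs xs v ≤ 1
  pointwise v with Q? v
  ... | yes q = s≤s (≤-reflexive (occurs-∉ xs (Q⇒∉ v q)))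
  ... | no _  = occurs-≤1 xs d v

length-concatMap-≤ : ∀ {c} (f : A → List B) xs → (∀ {x} → x ∈ xs → length (f x) ≤ c) →
  length (concatMap f xs) ≤ length xs * c
length-concatMap-≤ f []       _ = z≤n
length-concatMap-≤ f (x ∷ xs) b = ≤-trans (≤-reflexive (List.length-++ (f x)))
  (+-mono-≤ (b (here refl)) (length-concatMap-≤ f xs (b ∘ there)))

length-concatMap-≥ : ∀ {c} (f : A → List B) xs → (∀ {x} → x ∈ xs → c ≤ length (f x)) →
  length xs * c ≤ length (concatMap f xs)
length-concatMap-≥ f []       _ = z≤n
length-concatMap-≥ f (x ∷ xs) b = ≤-trans
  (+-mono-≤ (b (here refl)) (length-concatMap-≥ f xs (b ∘ there))) (≤-reflexive (sym (List.length-++ (f x))))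

unique-concatMap : (f : A → List B) {xs : List A} → (∀ x → Unique (f x)) →
  (∀ {x x′ y} → y ∈ f x → y ∈ f x′ → x ≡ x′) → Unique xs → Unique (concatMap f xs)
unique-concatMap f {[]}     _ _ _ = []
unique-concatMap f {x ∷ xs} uf disj (x∉ ∷ u) =
  Unique.++⁺ (uf x) (unique-concatMap f uf disj u)
    λ (y∈ , y∈′) → go x∉ (∈-concatMap⁻ f {xs = xs} y∈′) y∈
  where
  go : ∀ {y xs} → All (x ≢_) xs → Any ((y ∈_) ∘ f) xs → ¬ y ∈ f x
  go (x≢ ∷ _) (here y∈)  y∈′ = x≢ (disj y∈′ y∈)
  go (_ ∷ x≢) (there y∈) y∈′ = go x≢ y∈ y∈′

module _ (H : Graph h) where

  IndexPath : Vec (Fin h) k → Fin k → Fin k → Set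
  IndexPath xs = Star λ i j → Adj H (lookup xs i) (lookup xs j)

  -- Orders in which the vertices of H can be embedded one at a time; the last
  -- vertex comes first.  A root has no earlier neighbour, and the earlier
  -- neighbours of any other vertex lie in one component of the earlier graph.
  data Construction : Vec (Fin h) k → Set where
    []   : Construction []
    root : ∀ {x} {xs : Vec (Fin h) k} → x ∉ᵛ xs → (∀ i → ¬ Adj H x (lookup xs i)) →
           Construction xs → Construction (x ∷ xs)
    leaf : ∀ {x} {xs : Vec (Fin h) k} → x ∉ᵛ xs → ∀ i → Adj H x (lookup xs i) →
           (∀ j → Adj H x (lookup xs j) → IndexPath xs i j) →
           Construction xs → Construction (x ∷ xs)

  construction-distinct : {xs : Vec (Fin h) k} → Construction xs → Distinct xs
  construction-distinct []                ()
  construction-distinct (root x∉ _ c)     = distinct-∷ x∉ (construction-distinct c)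
  construction-distinct (leaf x∉ _ _ _ c) = distinct-∷ x∉ (construction-distinct c)

  private
    Boundary : Vec (Fin h) k → Fin k → Set
    Boundary xs i = ∃ λ x → x ∉ᵛ xs × Adj H x (lookup xs i)

    -- The invariant of the greedy construction. A root is taken only when the boundary is empty, so
    -- the boundary never meets two components and the path condition of `leaf` holds automatically.
    BoundaryConnected : Vec (Fin h) k → Set
    BoundaryConnected xs = ∀ i j → Boundary xs i → Boundary xs j → IndexPath xs i j

    boundary-suc : ∀ {x} {xs : Vec (Fin h) k} {i} → Boundary (x ∷ xs) (suc i) → Boundary xs i
    boundary-suc (y , y∉ , a) = y , y∉ ∘ suc , a

    path-suc : ∀ {x} {xs : Vec (Fin h) k} {i j} → IndexPath xs i j → IndexPath (x ∷ xs) (suc i) (suc j)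
    path-suc = Star.gmap suc id

    #∉-∷ : ∀ {x} (xs : Vec (Fin h) k) → x ∉ᵛ xs → # (_∉ᵛ? (x ∷ xs)) < # (_∉ᵛ? xs)
    #∉-∷ {x = x} xs x∉ = #-mono-< (_∉ᵛ? (x ∷ xs)) (_∉ᵛ? xs) (λ v v∉ i → v∉ (suc i)) x x∉ λ v∉ → v∉ zero refl

    extend : ∀ fuel {k} (xs : Vec (Fin h) k) → Construction xs → BoundaryConnected xs →
      # (_∉ᵛ? xs) ≤ fuel → ∃₂ λ k (ys : Vec (Fin h) k) → Construction ys × (∀ x → ∃ λ i → lookup ys i ≡ x)

    extend-∷ : ∀ fuel {k x} {xs : Vec (Fin h) k} → x ∉ᵛ xs → Construction (x ∷ xs) →
      BoundaryConnected (x ∷ xs) → # (_∉ᵛ? xs) ≤ fuel →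
      ∃₂ λ k (ys : Vec (Fin h) k) → Construction ys × (∀ x → ∃ λ i → lookup ys i ≡ x)
    extend-∷ zero       {xs = xs} x∉ c b ≤fuel = contradiction (≤-trans (#∉-∷ xs x∉) ≤fuel) λ ()
    extend-∷ (suc fuel) {xs = xs} x∉ c b ≤fuel = extend fuel _ c b (≤-pred (≤-trans (#∉-∷ xs x∉) ≤fuel))

    extend fuel {k} xs c b ≤fuel with any? (λ x → any? λ i → (x ∉ᵛ? xs) ×-dec adj? H x (lookup xs i))
    ... | yes (x , i , x∉ , a) = extend-∷ fuel {xs = xs} x∉ (leaf x∉ i a (λ j a′ → b i j (x , x∉ , a) (x , x∉ , a′)) c) b′ ≤fuel
      where
      b′ : BoundaryConnected (x ∷ xs)
      b′ zero    zero    _ _ = ε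
      -- Until it was placed, `x` witnessed that `i` lies on the boundary, so the old invariant
      -- joins `i` to `j`.
      b′ zero    (suc j) _ q = a ◅ path-suc (b i j (x , x∉ , a) (boundary-suc q))
      b′ (suc j) zero    q _ = path-suc (b j i (boundary-suc q) (x , x∉ , a)) ◅◅ (adj-sym H a ◅ ε)
      b′ (suc j) (suc l) q r = path-suc (b j l (boundary-suc q) (boundary-suc r))
    ... | no ¬leaf with any? (_∉ᵛ? xs)
    ...   | yes (x , x∉) = extend-∷ fuel {xs = xs} x∉ (root x∉ (λ i a → ¬leaf (x , i , x∉ , a)) c) b′ ≤fuel
      where
      b′ : BoundaryConnected (x ∷ xs)
      -- An earlier position on the boundary would have allowed a leaf, so only `x` can be there.
      b′ zero    zero    _ _ = ε
      b′ _       (suc j) _ (y , y∉ , a) = contradiction (y , j , y∉ ∘ suc , a) ¬leaf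
      b′ (suc i) _       (y , y∉ , a) _ = contradiction (y , i , y∉ ∘ suc , a) ¬leaf
    ...   | no all∈ = k , xs , c , covers
      where
      covers : ∀ x → ∃ λ i → lookup xs i ≡ x
      covers x with any? (λ i → lookup xs i ≟ x)
      ... | yes e = e
      ... | no ¬e = contradiction (x , λ i e → ¬e (i , e)) all∈

  construction : ∃₂ λ k (xs : Vec (Fin h) k) → Construction xs × (∀ x → ∃ λ i → lookup xs i ≡ x)
  construction = extend _ [] [] (λ ()) ≤-refl

  module Placements (G : Graph n) where

    Homomorphic : Vec (Fin h) k → Vec (Fin n) k → Set
    Homomorphic xs vs = ∀ i j → Adj H (lookup xs i) (lookup xs j) → Adj G (lookup vs i) (lookup vs j)

    Fits : Fin h → Vec (Fin h) k → Vec (Fin n) k → Fin n → Set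
    Fits x xs vs v = v ∉ᵛ vs × ∀ i → Adj H x (lookup xs i) → Adj G v (lookup vs i)

    fits? : ∀ x (xs : Vec (Fin h) k) vs → Decidable (Fits x xs vs)
    fits? x xs vs v = (v ∉ᵛ? vs) ×-dec all? λ i → adj? H x (lookup xs i) →-dec adj? G v (lookup vs i)

    extensions : Fin h → Vec (Fin h) k → Vec (Fin n) k → List (Vec (Fin n) (suc k))
    extensions x xs vs = map (_∷ vs) (filter (fits? x xs vs) (allFin n))

    -- The injective homomorphisms of the part of `H` on `xs`, each listed once. Generating them by
    -- extension reduces the comparison of two graphs to the number of choices for one vertex.
    placements : Vec (Fin h) k → List (Vec (Fin n) k)
    placements []       = [] ∷ []
    placements (x ∷ xs) = concatMap (extensions x xs) (placements xs)

    length-extensions : ∀ x (xs : Vec (Fin h) k) vs → length (extensions x xs vs) ≡ # (fits? x xs vs)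
    length-extensions x xs vs = trans
      (List.length-map (_∷ vs) (filter (fits? x xs vs) (allFin n))) (length-filter-tabulate (fits? x xs vs) id)

    placements-sound : (xs : Vec (Fin h) k) {vs : Vec (Fin n) k} → vs ∈ placements xs →
      Distinct vs × Homomorphic xs vs
    placements-sound []       {[]} _ = (λ ()) , λ ()
    placements-sound (x ∷ xs) {v ∷ vs} vs∈
      with ws , ws∈ , e∈ ← find (∈-concatMap⁻ (extensions x xs) {xs = placements xs} vs∈)
      with v , v∈ , refl ← ∈-map⁻ (_∷ ws) e∈
      with _ , v∉ , fit ← ∈-filter⁻ (fits? x xs ws) {xs = allFin n} v∈
         | d , hom ← placements-sound xs ws∈ =
      distinct-∷ v∉ d , λ where
        zero    zero    a → contradiction a (adj-irrefl H refl)
        zero    (suc j) a → fit j a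
        (suc i) zero    a → adj-sym G (fit i (adj-sym H a))
        (suc i) (suc j) a → hom i j a

    placements-complete : (xs : Vec (Fin h) k) {vs : Vec (Fin n) k} → Distinct vs → Homomorphic xs vs →
      vs ∈ placements xs
    placements-complete []       {[]}     _ _   = here refl
    placements-complete (x ∷ xs) {v ∷ vs} d hom with v∉ , d′ ← distinct-∷⁻ {x = v} {vs} d =
      ∈-concatMap⁺ (extensions x xs) (Any.map (λ { refl → ∈-map⁺ (_∷ vs)
        (∈-filter⁺ (fits? x xs vs) (∈-allFin v) (v∉ , λ i → hom zero (suc i))) })
        (placements-complete xs d′ (λ i j → hom (suc i) (suc j))))

    placements-unique : (xs : Vec (Fin h) k) → Unique (placements xs)
    placements-unique []       = [] ∷ []
    placements-unique (x ∷ xs) = unique-concatMap (extensions x xs)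
      (λ vs → Unique.map⁺ (λ { refl → refl }) (Unique.filter⁺ _ (Unique.tabulate⁺ id)))
      same-tail (placements-unique xs)
      where
      same-tail : ∀ {vs ws us} → us ∈ extensions x xs vs → us ∈ extensions x xs ws → vs ≡ ws
      same-tail p q with _ , _ , refl ← ∈-map⁻ _ p | _ , _ , refl ← ∈-map⁻ _ q = refl

    module _ (xs : Vec (Fin h) k) (distinct : Distinct xs) (position : ∀ x → ∃ λ i → lookup xs i ≡ x) where

      private
        idx : Fin h → Fin k
        idx x = proj₁ (position x)

        idx-lookup : ∀ i → idx (lookup xs i) ≡ i
        idx-lookup i = distinct _ i (proj₂ (position (lookup xs i)))

      embeddings-≤-placements : length (embeddings H G) ≤ length (placements xs)
      embeddings-≤-placements = length-≤-injection (λ c → Vec.map (finToFun c) xs) (embeddings-unique H G)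
        (λ {c} c∈ → let inj , hom = ∈-embeddings⁻ H G c∈ in placements-complete xs
          (λ i j e → distinct i j (inj
            (trans (sym (Vec.lookup-map i (finToFun c) xs)) (trans e (Vec.lookup-map j (finToFun c) xs)))))
          (λ i j a → subst₂ (Adj G) (sym (Vec.lookup-map i (finToFun c) xs))
            (sym (Vec.lookup-map j (finToFun c) xs)) (hom _ _ a)))
        (λ {c} {c′} _ _ e → finToFun-injective {n} {h} λ x →
          let i , p = position x in
          subst (λ y → finToFun c y ≡ finToFun c′ y) p
            (trans (sym (Vec.lookup-map i (finToFun c) xs)) 
              (trans (cong (λ vs → lookup vs i) e) (Vec.lookup-map i (finToFun c′) xs))))

      placements-≤-embeddings : length (placements xs) ≤ length (embeddings H G)
      placements-≤-embeddings = length-≤-injection (λ vs → funToFin (lookup vs ∘ idx)) (placements-unique xs)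
        (λ {vs} vs∈ → let d , hom = placements-sound xs vs∈ in ∈-embeddings⁺ H G
          ( (λ {x} {y} e → trans (sym (proj₂ (position x))) (trans (cong (lookup xs) (d _ _ e)) (proj₂ (position y))))
          , (λ x y a → hom _ _ (subst₂ (Adj H) (sym (proj₂ (position x))) (sym (proj₂ (position y))) a))))
        (λ {vs} {ws} _ _ e → trans (sym (Vec.tabulate∘lookup vs)) (trans (Vec.tabulate-cong λ i →
          subst (λ j → lookup vs j ≡ lookup ws j) (idx-lookup i)
            (trans (sym (Fin.finToFun-funToFin (lookup vs ∘ idx) (lookup xs i)))
              (trans (cong (λ c → finToFun c (lookup xs i)) e) (Fin.finToFun-funToFin (lookup ws ∘ idx) (lookup xs i)))))
          (Vec.tabulate∘lookup ws)))

  open Placements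

  -- Under this condition all neighbours of the image of the parent are
  -- admissible for a leaf, unless they are already taken.
  FreelyExtends : Graph n → Set
  FreelyExtends {n} G = ∀ {k x} (xs : Vec (Fin h) k) {i j} → Distinct xs → x ∉ᵛ xs →
    Adj H x (lookup xs i) → Adj H x (lookup xs j) → IndexPath xs i j →
    ∀ (vs : Vec (Fin n) k) → Homomorphic G xs vs → ∀ {v} → Adj G v (lookup vs i) → Adj G v (lookup vs j)

  module _ (G G′ : Graph n) {d d′ : ℕ} (d+h≤d′ : d + h ≤ d′)
           (deg≤ : ∀ v → degree G v ≤ d) (deg≥ : ∀ v → d′ ≤ degree G′ v) (free : FreelyExtends G′) where

    -- Each step multiplies the number of placements by at most `c` in `G` and by at least `c` in
    -- `G′`. For a root `c` is `n ∸ k`, the number of free vertices. For a leaf `c` is `d`: at most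
    -- `k` of the `d′` or more neighbours in `G′` are taken, and `k ≤ h` because the placed vertices
    -- of `H` are distinct.
    placements-mono : {xs : Vec (Fin h) k} → Construction xs → length (placements G xs) ≤ length (placements G′ xs)
    placements-mono-∷ : ∀ {x} {xs : Vec (Fin h) k} c → Construction xs →
      (∀ vs → Distinct vs → # (fits? G x xs vs) ≤ c) →
      (∀ vs → Homomorphic G′ xs vs → c ≤ # (fits? G′ x xs vs)) →
      length (placements G (x ∷ xs)) ≤ length (placements G′ (x ∷ xs))

    placements-mono-∷ {x = x} {xs} c κ upper lower = begin
      length (placements G (x ∷ xs))  ≤⟨ length-concatMap-≤ (extensions G x xs) (placements G xs) (λ {vs} vs∈ →
        ≤-trans (≤-reflexive (length-extensions G x xs vs)) (upper vs (proj₁ (placements-sound G xs vs∈)))) ⟩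
      length (placements G xs) * c    ≤⟨ *-monoˡ-≤ c (placements-mono κ) ⟩
      length (placements G′ xs) * c   ≤⟨ length-concatMap-≥ (extensions G′ x xs) (placements G′ xs) (λ {vs} vs∈ →
        ≤-trans (lower vs (proj₂ (placements-sound G′ xs vs∈))) (≤-reflexive (sym (length-extensions G′ x xs vs)))) ⟩
      length (placements G′ (x ∷ xs)) ∎
      where open ≤-Reasoning

    placements-mono [] = ≤-refl
    placements-mono {suc k} {x ∷ xs} (root x∉ isolated κ) = placements-mono-∷ (n ∸ k) κ
      (λ vs dist → m+n≤o⇒m≤o∸n _ (#-avoiding-≤ (fits? G x xs vs) vs dist λ _ → proj₁))
      (λ vs _ → m≤n+o⇒m∸n≤o _ k (begin
        n                                      ≡⟨ sym (trans (sum-const n 1) (*-identityʳ n)) ⟩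
        sum {n} (λ _ → 1)                      ≤⟨ #-avoiding-≥ {P = λ _ → ⊤} (λ _ → yes tt) (fits? G′ x xs vs) vs
                                                    (λ v _ v∉ → v∉ , λ i a → contradiction a (isolated i)) ⟩
        # (fits? G′ x xs vs) + k               ≡⟨ +-comm _ k ⟩
        k + # (fits? G′ x xs vs)               ∎))
      where
      open ≤-Reasoning
    placements-mono {suc k} {x ∷ xs} (leaf x∉ i a paths κ) = placements-mono-∷ d κ
      (λ vs _ → begin
        # (fits? G x xs vs)             ≤⟨ #-mono (fits? G x xs vs) (adj? G (lookup vs i)) (λ v (_ , fit) → adj-sym G (fit i a)) ⟩
        # (adj? G (lookup vs i))        ≡⟨ sym (degree≡# G (lookup vs i)) ⟩
        degree G (lookup vs i)          ≤⟨ deg≤ (lookup vs i) ⟩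
        d                               ∎)
      (λ vs hom → +-cancelʳ-≤ k _ _ (begin
        d + k                           ≤⟨ +-monoʳ-≤ d (Fin.injective⇒≤ {f = lookup xs} λ {i} {j} → dist i j) ⟩
        d + h                           ≤⟨ d+h≤d′ ⟩
        d′                              ≤⟨ deg≥ (lookup vs i) ⟩
        degree G′ (lookup vs i)         ≡⟨ degree≡# G′ (lookup vs i) ⟩
        # (adj? G′ (lookup vs i))       ≤⟨ #-avoiding-≥ (adj? G′ (lookup vs i)) (fits? G′ x xs vs) vs (λ v a′ v∉ →
                                              v∉ , λ j a″ → free xs dist x∉ a a″ (paths j a″) vs hom (adj-sym G′ a′)) ⟩
        # (fits? G′ x xs vs) + k        ∎))
      where
      open ≤-Reasoning
      dist : Distinct xs
      dist = construction-distinct κ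

    embeddings-≤-degree : length (embeddings H G) ≤ length (embeddings H G′)
    embeddings-≤-degree with k , xs , κ , position ← construction =
      ≤-trans (embeddings-≤-placements G xs (construction-distinct κ) position)
        (≤-trans (placements-mono κ)
          (placements-≤-embeddings G′ xs (construction-distinct κ) position))

-- Bipartite graphs and forests extend freely

≢-≢⇒≡ : {a b c : Bool} → a ≢ b → a ≢ c → b ≡ c
≢-≢⇒≡ {b = true}  {true}  _ _ = refl
≢-≢⇒≡ {b = false} {false} _ _ = refl
≢-≢⇒≡ {true}  {true}  {false} p _ = contradiction refl p
≢-≢⇒≡ {false} {true}  {false} _ q = contradiction refl q
≢-≢⇒≡ {true}  {false} {true}  _ q = contradiction refl q
≢-≢⇒≡ {false} {false} {true}  p _ = contradiction refl p

≢-≢⇒xor-≡ : {a b c d : Bool} → a ≢ b → c ≢ d → a xor c ≡ b xor d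
≢-≢⇒xor-≡ {true}  {true}  p _ = contradiction refl p
≢-≢⇒xor-≡ {false} {false} p _ = contradiction refl p
≢-≢⇒xor-≡ {c = true}  {true}  _ q = contradiction refl q
≢-≢⇒xor-≡ {c = false} {false} _ q = contradiction refl q
≢-≢⇒xor-≡ {true}  {false} {true}  {false} _ _ = refl
≢-≢⇒xor-≡ {true}  {false} {false} {true}  _ _ = refl
≢-≢⇒xor-≡ {false} {true}  {true}  {false} _ _ = refl
≢-≢⇒xor-≡ {false} {true}  {false} {true}  _ _ = refl

xor-cancelʳ : ∀ {a b} c → a xor c ≡ b xor c → a ≡ b
xor-cancelʳ {true}  {true}  c     _ = refl
xor-cancelʳ {false} {false} c     _ = refl
xor-cancelʳ {true}  {false} true  ()
xor-cancelʳ {true}  {false} false ()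
xor-cancelʳ {false} {true}  true  ()
xor-cancelʳ {false} {true}  false ()

-- Along a walk the side in T₂ and the colour in H change together, so their
-- exclusive or is constant on each component of the part already embedded.
bipartite-freelyExtends : (H : Graph h) → Bipartite H → FreelyExtends H (T₂ n)
bipartite-freelyExtends {n = n} H (colour , proper) xs {i} {j} dist x∉ a a′ path vs hom v≢ v≡ =
  v≢ (trans v≡ (sym (xor-cancelʳ (colour (lookup xs i))
    (trans (invariant path) (cong (side (lookup vs j) xor_) (sym same-colour))))))
  where
  side : Fin n → Bool
  side v = does (toℕ v <? ⌊ n /2⌋)

  same-colour : colour (lookup xs i) ≡ colour (lookup xs j)
  same-colour = ≢-≢⇒≡ (proper _ _ a) (proper _ _ a′)

  invariant : ∀ {i j} → IndexPath H xs i j →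
    side (lookup vs i) xor colour (lookup xs i) ≡ side (lookup vs j) xor colour (lookup xs j)
  invariant ε = refl
  invariant {i} (_◅_ {j = m} b p) = trans (≢-≢⇒xor-≡ (hom i m b) (proper _ _ b)) (invariant p)

module _ {A : Set} (R : A → A → Set) where

  data Walk : A → A → List A → Set where
    []  : ∀ {i} → Walk i i []
    _∷_ : ∀ {i m j zs} → R i m → Walk m j zs → Walk i j (m ∷ zs)

  walk-suffix : ∀ {i m j zs} → Walk m j zs → Unique (m ∷ zs) → i ∈ m ∷ zs →
    ∃ λ ws → Walk i j ws × Unique (i ∷ ws)
  walk-suffix w       u       (here refl) = _ , w , u
  walk-suffix (_ ∷ w) (_ ∷ u) (there i∈)  = walk-suffix w u i∈

  walk-step : ∀ {i j zs} → Walk i j zs → ∀ p q → toℕ q ≡ suc (toℕ p) →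
    R (List.lookup (i ∷ zs) p) (List.lookup (i ∷ zs) q)
  walk-step (r ∷ _) zero    (suc zero)    _ = r
  walk-step (_ ∷ w) (suc p) (suc q)       e = walk-step w p q (ℕ.suc-injective e)

  walk-last : ∀ {i j zs} → Walk i j zs → ∀ p → toℕ p ≡ length zs → List.lookup (i ∷ zs) p ≡ j
  walk-last []      zero    _ = refl
  walk-last (_ ∷ w) (suc p) e = walk-last w p (ℕ.suc-injective e)

-- If the start recurs on the repetition-free walk found for the rest, the suffix from that
-- recurrence replaces the whole walk.
star⇒walk : {R : Fin k → Fin k → Set} {i j : Fin k} → Star R i j → ∃ λ zs → Walk R i j zs × Unique (i ∷ zs)
star⇒walk ε = [] , [] , ([] ∷ [])
star⇒walk {R = R} {i} (r ◅ s) with zs , w , u ← star⇒walk s with Any.any? (i ≟_) (_ ∷ zs)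
... | yes i∈ = walk-suffix R w u i∈
... | no i∉  = _ , r ∷ w , (¬Any⇒All¬ _ i∉ ∷ u)

-- A nonempty repetition-free walk from `i` to `j` avoids `x`, so `x` closes it to a cycle; the
-- vertices `x`, `i`, `m` and those of `zs` make its length `3 + length zs`.
acyclic⇒unique-neighbour : (H : Graph h) → Acyclic H → (xs : Vec (Fin h) k) → Distinct xs →
  ∀ {x i j} → x ∉ᵛ xs → Adj H x (lookup xs i) → Adj H x (lookup xs j) → IndexPath H xs i j → i ≡ j
acyclic⇒unique-neighbour {h = h} {k = k} H acyclic xs dist {x} {i} {j} x∉ a a′ path
  with star⇒walk path
... | []     , []   , _ = refl
... | m ∷ zs , walk , unique = ⊥-elim (acyclic (length zs) (f , injective , homomorphic))
  where
  ℓ = length zs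

  f : Fin (3 + ℓ) → Fin h
  f zero    = x
  f (suc p) = lookup xs (List.lookup (i ∷ m ∷ zs) p)

  injective : ∀ {p q} → f p ≡ f q → p ≡ q
  injective {zero}  {zero}  _ = refl
  injective {zero}  {suc q} e = contradiction (sym e) (x∉ _)
  injective {suc p} {zero}  e = contradiction e (x∉ _)
  injective {suc p} {suc q} e = cong suc (lookup-injective unique (dist _ _ e))

  step : ∀ p q → toℕ q ≡ suc (suc (toℕ p)) → Adj H (f (suc p)) (f q)
  step p (suc q) e = walk-step _ walk p q (ℕ.suc-injective e)

  wrap : ∀ p q → toℕ p ≡ suc ℓ → toℕ q ≡ 0 → Adj H (f (suc p)) (f q)
  wrap p zero e _ = subst (λ y → Adj H (lookup xs y) x) (sym (walk-last _ walk p e)) (adj-sym H a′)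

  next : ∀ p q → toℕ q ≡ suc (toℕ p) % (3 + ℓ) → Adj H (f p) (f q)
  next zero    (suc zero) _ = a
  next (suc p) q e with suc (suc (toℕ p)) <? 3 + ℓ
  ... | yes l = step p q (trans e (m<n⇒m%n≡m l))
  ... | no ≮  = wrap p q (ℕ.suc-injective (ℕ.suc-injective last))
                         (trans e (trans (cong (_% (3 + ℓ)) last) (n%n≡0 (3 + ℓ))))
    where
    last : suc (suc (toℕ p)) ≡ 3 + ℓ
    last = ≤-antisym (s≤s (Fin.toℕ<n p)) (≮⇒≥ ≮)

  homomorphic : ∀ p q → Adj (Cycle ℓ) p q → Adj H (f p) (f q)
  homomorphic p q (inj₁ e) = next p q e
  homomorphic p q (inj₂ e) = adj-sym H (next q p e)

acyclic-freelyExtends : (H : Graph h) → Acyclic H → (G : Graph n) → FreelyExtends H G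
acyclic-freelyExtends H acyclic G xs dist x∉ a a′ path vs _ {v} b =
  subst (λ i → Adj G v (lookup vs i)) (acyclic⇒unique-neighbour H acyclic xs dist x∉ a a′ path) b

-- Triangle-free graphs of large degree

TriangleFree : Graph n → Set
TriangleFree G = ∀ u v w → Adj G u v → Adj G v w → ¬ Adj G u w

K₃-free⇒triangleFree : (G : Graph n) → K 3 -Free G → TriangleFree G
K₃-free⇒triangleFree {n} G free u v w uv vw uw = free (f , (λ {x} {y} → injective x y) , homomorphic)
  where
  f : Fin 3 → Fin n
  f = lookup (u ∷ v ∷ w ∷ [])

  homomorphic : ∀ x y → x ≢ y → Adj G (f x) (f y)
  homomorphic zero             zero             x≢y = contradiction refl x≢y
  homomorphic zero             (suc zero)       _   = uv
  homomorphic zero             (suc (suc zero)) _   = uw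
  homomorphic (suc zero)       zero             _   = adj-sym G uv
  homomorphic (suc zero)       (suc zero)       x≢y = contradiction refl x≢y
  homomorphic (suc zero)       (suc (suc zero)) _   = vw
  homomorphic (suc (suc zero)) zero             _   = adj-sym G uw
  homomorphic (suc (suc zero)) (suc zero)       _   = adj-sym G vw
  homomorphic (suc (suc zero)) (suc (suc zero)) x≢y = contradiction refl x≢y

  injective : ∀ x y → f x ≡ f y → x ≡ y
  injective x y e = decidable-stable (x ≟ y) λ x≢y → adj-irrefl G e (homomorphic x y x≢y)

triangleFree⇒K₃-free : (G : Graph n) → TriangleFree G → K 3 -Free G
triangleFree⇒K₃-free G free (f , _ , hom) =
  free _ _ _ (hom zero (suc zero) λ ()) (hom (suc zero) (suc (suc zero)) λ ()) (hom zero (suc (suc zero)) λ ())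

bipartite⇒triangleFree : (G : Graph n) → Bipartite G → TriangleFree G
bipartite⇒triangleFree G (side , proper) u v w uv vw uw
  with side u | side v | side w | proper u v uv | proper v w vw | proper u w uw
... | true  | true  | _     | p | _ | _ = p refl
... | false | false | _     | p | _ | _ = p refl
... | _     | true  | true  | _ | p | _ = p refl
... | _     | false | false | _ | p | _ = p refl
... | true  | _     | true  | _ | _ | p = p refl
... | false | _     | false | _ | _ | p = p refl

#-disjoint₃ : {P : Pred (Fin n) p} {Q : Pred (Fin n) q} {R : Pred (Fin n) r}
  (P? : Decidable P) (Q? : Decidable Q) (R? : Decidable R) →
  (∀ i → P i → ¬ Q i) → (∀ i → P i → ¬ R i) → (∀ i → Q i → ¬ R i) → # P? + (# Q? + # R?) ≤ n
#-disjoint₃ {n = n} P? Q? R? pq pr qr = begin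
  # P? + (# Q? + # R?)                                   ≡⟨ cong (# P? +_) (sym (∑-distrib-+ (λ i → ⟦ Q? i ⟧) λ i → ⟦ R? i ⟧)) ⟩
  # P? + sum (λ i → ⟦ Q? i ⟧ + ⟦ R? i ⟧)                 ≡⟨ sym (∑-distrib-+ (λ i → ⟦ P? i ⟧) _) ⟩
  sum (λ i → ⟦ P? i ⟧ + (⟦ Q? i ⟧ + ⟦ R? i ⟧))           ≤⟨ sum-mono pointwise ⟩
  sum {n} (λ _ → 1)                                      ≡⟨ trans (sum-const n 1) (*-identityʳ n) ⟩
  n                                                      ∎
  where
  open ≤-Reasoning
  pointwise : ∀ i → ⟦ P? i ⟧ + (⟦ Q? i ⟧ + ⟦ R? i ⟧) ≤ 1
  pointwise i with P? i | Q? i | R? i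
  ... | yes x | yes y | _     = contradiction y (pq i x)
  ... | yes x | no _  | yes z = contradiction z (pr i x)
  ... | no _  | yes y | yes z = contradiction z (qr i y)
  ... | yes _ | no _  | no _  = ≤-refl
  ... | no _  | yes _ | no _  = ≤-refl
  ... | no _  | no _  | yes _ = ≤-refl
  ... | no _  | no _  | no _  = z≤n

next : Fin 5 → Fin 5
next zero                             = suc zero
next (suc zero)                       = suc (suc zero)
next (suc (suc zero))                 = suc (suc (suc zero))
next (suc (suc (suc zero)))           = suc (suc (suc (suc zero)))
next (suc (suc (suc (suc zero))))     = zero

next⁵ : ∀ i → next (next (next (next (next i)))) ≡ i
next⁵ = toWitness {a? = all? λ i → next (next (next (next (next i)))) ≟ i} _

next-Adj : ∀ i → Adj C₅ i (next i)
next-Adj = toWitness {a? = all? λ i → adj? C₅ i (next i)} _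

-- The map c need not be injective, but it is if G is triangle-free.
ClosedWalk₅ : Graph n → (Fin 5 → Fin n) → Set
ClosedWalk₅ G c = ∀ i → Adj G (c i) (c (next i))

commonNeighbour? : (G : Graph n) → ∀ v u → Dec (∃ λ x → Adj G v x × Adj G u x)
commonNeighbour? G v u = any? λ x → adj? G v x ×-dec adj? G u x

-- Two adjacent vertices that have no common neighbour with v would have,
-- together with v, pairwise disjoint neighbourhoods.
closedWalk₅-or-bipartite : (G : Graph n) → TriangleFree G → Fin n → ∀ {d} →
  (∀ v → degree G v ≡ d) → n < d + (d + d) → ∃ (ClosedWalk₅ G) ⊎ Bipartite G
closedWalk₅-or-bipartite {n} G free v {d} deg n<3d
  with any? (λ x → any? λ y →
    adj? G x y ×-dec (does (commonNeighbour? G v x) Bool.≟ does (commonNeighbour? G v y)))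
... | no ¬e = inj₂ ((λ u → does (commonNeighbour? G v u)) , λ x y a e → ¬e (x , y , a , e))
... | yes (x , y , a , e) = inj₁ (walk (commonNeighbour? G v x) (commonNeighbour? G v y) e)
  where
  nbhd : ∀ u → # (adj? G u) ≡ d
  nbhd u = trans (sym (degree≡# G u)) (deg u)

  walk : (p : Dec (∃ λ z → Adj G v z × Adj G x z)) (q : Dec (∃ λ z → Adj G v z × Adj G y z)) →
    does p ≡ does q → ∃ (ClosedWalk₅ G)
  walk (yes (x′ , vx′ , xx′)) (yes (y′ , vy′ , yy′)) _ = lookup (v ∷ x′ ∷ x ∷ y ∷ y′ ∷ []) , λ where
    zero → vx′
    (suc zero) → adj-sym G xx′
    (suc (suc zero)) → a
    (suc (suc (suc zero))) → yy′
    (suc (suc (suc (suc zero)))) → adj-sym G vy′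
  walk (no ¬p) (no ¬q) _ = contradiction (<-≤-trans n<3d (subst (_≤ n)
    (cong₂ _+_ (nbhd v) (cong₂ _+_ (nbhd x) (nbhd y)))
    (#-disjoint₃ (adj? G v) (adj? G x) (adj? G y) (λ z vz xz → ¬p (z , vz , xz)) (λ z vz yz → ¬q (z , vz , yz))
      (λ z xz yz → free _ _ _ a yz xz)))) (n≮n n)

-- The independence number of C₅ is two.
at-most-two : ∀ {A B C D E : Set} (a : Dec A) (b : Dec B) (c : Dec C) (d : Dec D) (e : Dec E) →
  (A → ¬ B) → (B → ¬ C) → (C → ¬ D) → (D → ¬ E) → (E → ¬ A) →
  ⟦ a ⟧ + (⟦ b ⟧ + (⟦ c ⟧ + (⟦ d ⟧ + (⟦ e ⟧ + 0)))) ≤ 2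
at-most-two (yes a) (yes b) _       _       _       ab _ _ _ _ = contradiction b (ab a)
at-most-two (yes a) (no _)  (yes c) (yes d) _       _ _ cd _ _ = contradiction d (cd c)
at-most-two (yes a) (no _)  _       _       (yes e) _ _ _ _ ea = contradiction a (ea e)
at-most-two (yes _) (no _)  (yes _) (no _)  (no _)  _ _ _ _ _  = ≤-refl
at-most-two (yes _) (no _)  (no _)  (yes _) (no _)  _ _ _ _ _  = ≤-refl
at-most-two (yes _) (no _)  (no _)  (no _)  (no _)  _ _ _ _ _  = s≤s z≤n
at-most-two (no _)  (yes b) (yes c) _       _       _ bc _ _ _ = contradiction c (bc b)
at-most-two (no _)  (yes _) (no _)  (yes d) (yes e) _ _ _ de _ = contradiction e (de d)
at-most-two (no _)  (yes _) (no _)  (yes _) (no _)  _ _ _ _ _  = ≤-refl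
at-most-two (no _)  (yes _) (no _)  (no _)  (yes _) _ _ _ _ _  = ≤-refl
at-most-two (no _)  (yes _) (no _)  (no _)  (no _)  _ _ _ _ _  = s≤s z≤n
at-most-two (no _)  (no _)  (yes c) (yes d) _       _ _ cd _ _ = contradiction d (cd c)
at-most-two (no _)  (no _)  (yes _) (no _)  (yes _) _ _ _ _ _  = ≤-refl
at-most-two (no _)  (no _)  (yes _) (no _)  (no _)  _ _ _ _ _  = s≤s z≤n
at-most-two (no _)  (no _)  (no _)  (yes d) (yes e) _ _ _ de _ = contradiction e (de d)
at-most-two (no _)  (no _)  (no _)  (yes _) (no _)  _ _ _ _ _  = s≤s z≤n
at-most-two (no _)  (no _)  (no _)  (no _)  (yes _) _ _ _ _ _  = s≤s z≤n
at-most-two (no _)  (no _)  (no _)  (no _)  (no _)  _ _ _ _ _  = z≤n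

#-≤1 : {P : Pred (Fin n) p} (P? : Decidable P) → (∀ i j → P i → P j → i ≡ j) → # P? ≤ 1
#-≤1 P? unique with any? P?
... | yes (i , x) = ≤-trans (#-mono P? (_≟ i) (λ j y → unique j i y x)) (≤-reflexive (#-≟ i))
... | no ¬x = ≤-trans (≤-reflexive (#-zero P? λ i x → ¬x (i , x))) z≤n

-- In a regular triangle-free graph with a closed walk c of length 5, almost all
-- vertices u are adjacent to c j and c (j + 2) for some j if the degree is close
-- to 2n/5; β counts the exceptional vertices.
module NearExtremal (G : Graph n) (free : TriangleFree G) {d : ℕ} (deg : ∀ v → degree G v ≡ d)
                    (c : Fin 5 → Fin n) (walk : ClosedWalk₅ G c) where

  nbhd : ∀ u → # (adj? G u) ≡ d
  nbhd u = trans (sym (degree≡# G u)) (deg u)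

  Between : Fin 5 → Fin n → Set
  Between j u = Adj G (c j) u × Adj G (c (next (next j))) u

  between? : ∀ j → Decidable (Between j)
  between? j u = adj? G (c j) u ×-dec adj? G (c (next (next j))) u

  Exceptional : Fin n → Set
  Exceptional u = ¬ ∃ λ j → Between j u

  exceptional? : Decidable Exceptional
  exceptional? u = ¬? (any? λ j → between? j u)

  β : ℕ
  β = # exceptional?

  private
    triangle : ∀ {x y} z → Adj G z x → Adj G z y → ¬ Adj G x y
    triangle z zx zy xy = free _ _ _ zx xy zy

    not-consecutive : ∀ j u → Adj G (c j) u → ¬ Adj G (c (next j)) u
    not-consecutive j u a b = free _ _ _ (walk j) b a

    neighbours : ∀ u → # (λ i → adj? G (c i) u) ≤ 2
    neighbours u = at-most-two (adj? G (c zero) u) (adj? G (c (suc zero)) u) (adj? G (c (suc (suc zero))) u)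
      (adj? G (c (suc (suc (suc zero)))) u) (adj? G (c (suc (suc (suc (suc zero))))) u)
      (not-consecutive _ u) (not-consecutive _ u) (not-consecutive _ u) (not-consecutive _ u) (not-consecutive _ u)

    relative : ∀ i j → (i ≡ j) ⊎ (j ≡ next i) ⊎ (i ≡ next j) ⊎ (j ≡ next (next i)) ⊎ (i ≡ next (next j))
    relative = toWitness {a? = all? λ i → all? λ j → (i ≟ j) ⊎-dec (j ≟ next i) ⊎-dec (i ≟ next j)
      ⊎-dec (j ≟ next (next i)) ⊎-dec (i ≟ next (next j))} _

    exceptional-neighbours : ∀ {u} → Exceptional u → # (λ i → adj? G (c i) u) ≤ 1
    exceptional-neighbours {u} exc = #-≤1 (λ i → adj? G (c i) u) unique
      where
      unique : ∀ i j → Adj G (c i) u → Adj G (c j) u → i ≡ j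
      unique i j a b with relative i j
      ... | inj₁ e = e
      ... | inj₂ (inj₁ refl) = contradiction b (not-consecutive i u a)
      ... | inj₂ (inj₂ (inj₁ refl)) = contradiction a (not-consecutive j u b)
      ... | inj₂ (inj₂ (inj₂ (inj₁ refl))) = contradiction (i , a , b) exc
      ... | inj₂ (inj₂ (inj₂ (inj₂ refl))) = contradiction (j , b , a) exc

  -- Double counting of the pairs of a position on the walk and a neighbour of its vertex: there are
  -- 5d of them, and a vertex `u` is in at most two, or at most one if it is exceptional.
  β+5d≤2n : β + 5 * d ≤ n * 2
  β+5d≤2n = begin
    β + 5 * d                                              ≡⟨ cong (β +_) (sym (trans (sum-cong-≗ (nbhd ∘ c)) (sum-const 5 d))) ⟩
    β + sum (λ i → sum λ u → ⟦ adj? G (c i) u ⟧)           ≡⟨ cong (β +_) (∑-comm λ i u → ⟦ adj? G (c i) u ⟧) ⟩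
    β + sum (λ u → sum λ i → ⟦ adj? G (c i) u ⟧)           ≡⟨ sym (∑-distrib-+ (λ u → ⟦ exceptional? u ⟧) _) ⟩
    sum (λ u → ⟦ exceptional? u ⟧ + # (λ i → adj? G (c i) u)) ≤⟨ sum-mono pointwise ⟩
    sum {n} (λ _ → 2)                                      ≡⟨ sum-const n 2 ⟩
    n * 2                                                  ∎
    where
    open ≤-Reasoning
    pointwise : ∀ u → ⟦ exceptional? u ⟧ + # (λ i → adj? G (c i) u) ≤ 2
    pointwise u with exceptional? u
    ... | yes exc = s≤s (exceptional-neighbours exc)
    ... | no _    = neighbours u

  private
    Outside : Fin n → Fin n → Fin n → Set
    Outside x y u = Adj G x u × ¬ Adj G y u

    outside? : ∀ x y → Decidable (Outside x y)
    outside? x y u = adj? G x u ×-dec ¬? (adj? G y u)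

    -- The centre of the walk between c j and c (j + 2) is c (j + 1).
    between⇒covers-centre : ∀ {j x} → Between j x → # (outside? (c (next j)) x) ≤ β
    -- Both neighbourhoods have `d` elements, so it suffices to bound the neighbours of `x` that are
    -- not neighbours of the centre; these are all exceptional.
    between⇒covers-centre {j} {x} (jx , j²x) = +-cancelˡ-≤ (# common?) _ _ (begin
      # common? + # (outside? (c (next j)) x)  ≡⟨ sym (#-split (adj? G (c (next j))) (adj? G x)) ⟩
      # (adj? G (c (next j)))                  ≡⟨ trans (nbhd _) (sym (nbhd x)) ⟩
      # (adj? G x)                             ≤⟨ #-⊎ (adj? G x) common? exceptional? covered ⟩
      # common? + β                            ∎)
      where
      open ≤-Reasoning
      common? : Decidable (λ u → Adj G (c (next j)) u × Adj G x u)
      common? u = adj? G (c (next j)) u ×-dec adj? G x u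

      -- As `u` is adjacent to `x`, it is adjacent neither to `c j` nor to `c (j + 2)`. Every pair
      -- of indices at distance two that avoids `j` and `j + 2` contains `j + 1`.
      covered : ∀ u → Adj G x u → (Adj G (c (next j)) u × Adj G x u) ⊎ Exceptional u
      covered u xu with adj? G (c (next j)) u
      ... | yes a = inj₁ (a , xu)
      ... | no ¬a = inj₂ λ (i , iu , i²u) → case i iu i²u (relative i j)
        where
        case : ∀ i → Adj G (c i) u → Adj G (c (next (next i))) u →
          (i ≡ j) ⊎ (j ≡ next i) ⊎ (i ≡ next j) ⊎ (j ≡ next (next i)) ⊎ (i ≡ next (next j)) → ⊥
        case i iu i²u (inj₁ refl) = triangle _ jx iu xu
        case i iu i²u (inj₂ (inj₁ refl)) = ¬a i²u
        case i iu i²u (inj₂ (inj₂ (inj₁ refl))) = ¬a iu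
        case i iu i²u (inj₂ (inj₂ (inj₂ (inj₁ refl)))) = triangle _ jx i²u xu
        case i iu i²u (inj₂ (inj₂ (inj₂ (inj₂ refl)))) = triangle _ j²x iu xu

    Small : Fin n → Fin 5 → Set
    Small w j = # (λ u → adj? G w u ×-dec between? j u) ≤ β

    Touches : Fin n → Fin 5 → Set
    Touches w j = ∃ λ x → Adj G w x × Between j x

    touches? : ∀ w j → Dec (Touches w j)
    touches? w j = any? λ x → adj? G w x ×-dec between? j x

    ¬touches⇒small : ∀ {w j} → ¬ Touches w j → Small w j
    ¬touches⇒small {w} {j} ¬t =
      ≤-trans (≤-reflexive (#-zero (λ u → adj? G w u ×-dec between? j u) λ x p → ¬t (x , p))) z≤n

    -- Neighbours of `w` are not adjacent to its neighbour `x`. Those between positions `i` are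
    -- adjacent to the centre `c (next j)`, hence belong to its at most β neighbours outside the
    -- neighbourhood of `x`.
    touches⇒small : ∀ {w j} i → Touches w j → (∀ {u} → Between i u → Adj G (c (next j)) u) → Small w i
    touches⇒small {w} {j} i (x , wx , jx) f = ≤-trans
      (#-mono (λ u → adj? G w u ×-dec between? i u) (outside? (c (next j)) x)
        λ u (wu , iu) → f iu , λ xu → triangle w wx wu xu)
      (between⇒covers-centre jx)

    touches⇒small-next : ∀ {w j} → Touches w j → Small w (next j)
    touches⇒small-next t = touches⇒small _ t proj₁

    touches⇒small-previous : ∀ {w j} → Touches w j → Small w (next (next (next (next j))))
    touches⇒small-previous {j = j} t = touches⇒small _ t λ {u} b →
      subst (λ i → Adj G (c i) u) (cong next (next⁵ j)) (proj₂ b)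

    Type : Fin n → Fin 5 → Set
    Type w i = # (outside? (c i) w) ≤ β + (β + (β + β))

    -- The vertices of classes `i` and `i + 3` are adjacent to `c i`. Only the other three classes
    -- and the exceptional vertices can contribute neighbours of `w` not adjacent to `c i`, at most
    -- β each; equal degrees turn this into a bound on `Outside (c i) w`.
    small⇒type : ∀ {w i} → Small w (next i) → Small w (next (next i)) → Small w (next (next (next (next i)))) → Type w i
    small⇒type {w} {i} s₁ s₂ s₄ = +-cancelˡ-≤ (# common?) _ _ (begin
      # common? + # (outside? (c i) w)  ≡⟨ sym (#-split (adj? G (c i)) (adj? G w)) ⟩
      # (adj? G (c i))                  ≡⟨ trans (nbhd _) (sym (nbhd w)) ⟩
      # (adj? G w)                      ≤⟨ #-⊎ (adj? G w) common? rest? covered ⟩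
      # common? + # rest?               ≤⟨ +-monoʳ-≤ (# common?) (≤-trans
          (#-⊎ rest? (at i₁) rest₂? (λ _ → id)) (+-mono-≤ s₁ (≤-trans
          (#-⊎ rest₂? (at i₂) rest₄? (λ _ → id)) (+-mono-≤ s₂ (≤-trans
          (#-⊎ rest₄? (at i₄) exceptional? (λ _ → id)) (+-monoˡ-≤ β s₄)))))) ⟩
      # common? + (β + (β + (β + β)))   ∎)
      where
      open ≤-Reasoning
      i₁ = next i
      i₂ = next i₁
      i₄ = next (next i₂)

      common? : Decidable (λ u → Adj G (c i) u × Adj G w u)
      common? u = adj? G (c i) u ×-dec adj? G w u

      BetweenAt : Fin 5 → Fin n → Set
      BetweenAt j u = Adj G w u × Between j u

      at : ∀ j → Decidable (BetweenAt j)
      at j u = adj? G w u ×-dec between? j u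

      rest₄? : Decidable (λ u → BetweenAt i₄ u ⊎ Exceptional u)
      rest₄? u = at i₄ u ⊎-dec exceptional? u

      rest₂? : Decidable (λ u → BetweenAt i₂ u ⊎ (BetweenAt i₄ u ⊎ Exceptional u))
      rest₂? u = at i₂ u ⊎-dec rest₄? u

      rest? : Decidable (λ u → BetweenAt i₁ u ⊎ (BetweenAt i₂ u ⊎ (BetweenAt i₄ u ⊎ Exceptional u)))
      rest? u = at i₁ u ⊎-dec rest₂? u

      covered : ∀ u → Adj G w u → 
        (Adj G (c i) u × Adj G w u) ⊎ (BetweenAt i₁ u ⊎ (BetweenAt i₂ u ⊎ (BetweenAt i₄ u ⊎ Exceptional u)))
      covered u wu with adj? G (c i) u | any? (λ j → between? j u)
      ... | yes a | _     = inj₁ (a , wu)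
      ... | no _  | no ¬b = inj₂ (inj₂ (inj₂ (inj₂ ¬b)))
      ... | no ¬a | yes (j , ju , j²u) = inj₂ (case j ju j²u (relative i j))
        where
        case : ∀ j → Adj G (c j) u → Adj G (c (next (next j))) u →
          (i ≡ j) ⊎ (j ≡ next i) ⊎ (i ≡ next j) ⊎ (j ≡ next (next i)) ⊎ (i ≡ next (next j)) → _
        case j ju j²u (inj₁ refl) = contradiction ju ¬a
        case j ju j²u (inj₂ (inj₁ refl)) = inj₁ (wu , ju , j²u)
        case j ju j²u (inj₂ (inj₂ (inj₁ refl))) = inj₂ (inj₂ (inj₁ (wu ,
          subst (λ k → Between k u) (sym (next⁵ j)) (ju , j²u))))
        case j ju j²u (inj₂ (inj₂ (inj₂ (inj₁ refl)))) = inj₂ (inj₁ (wu , ju , j²u))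
        case j ju j²u (inj₂ (inj₂ (inj₂ (inj₂ refl)))) = contradiction j²u ¬a

    -- Touching class `j` makes classes `j + 1` and `j + 4` small. If `j + 2` is not touched, type
    -- `j` fits. If it is, then `j + 3` is small too and type `j + 2` fits. A vertex touching no
    -- class may get any type.
    type : ∀ w → ∃ (Type w)
    type w with any? (touches? w)
    ... | no ¬t = zero , small⇒type (small _) (small _) (small _)
      where
      small : ∀ j → Small w j
      small j = ¬touches⇒small λ t → ¬t (j , t)
    ... | yes (j , t) with touches? w (next (next j))
    ...   | no ¬t  = j , small⇒type (touches⇒small-next t) (¬touches⇒small ¬t) (touches⇒small-previous t)
    ...   | yes t′ = next (next j) , small⇒type (touches⇒small-next t′) (touches⇒small-previous t)
              (subst (Small w) (sym (cong next (next⁵ j))) (touches⇒small-next t))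

    -- A common neighbour of `c i` and `c i′` is not adjacent to both `w` and `w′`, since these are
    -- adjacent; the types bound either failure by 4β.
    common-≤ : ∀ {w w′ i i′} → Type w i → Type w′ i′ → Adj G w w′ →
      # (λ u → adj? G (c i) u ×-dec adj? G (c i′) u) ≤ (β + (β + (β + β))) + (β + (β + (β + β)))
    common-≤ {w} {w′} {i} {i′} t t′ a = ≤-trans
      (#-⊎ (λ u → adj? G (c i) u ×-dec adj? G (c i′) u) (outside? (c i) w) (outside? (c i′) w′) covered)
      (+-mono-≤ t t′)
      where
      covered : ∀ u → Adj G (c i) u × Adj G (c i′) u → Outside (c i) w u ⊎ Outside (c i′) w′ u
      covered u (iu , i′u) with adj? G w u
      ... | yes wu = inj₂ (i′u , λ w′u → free _ _ _ a w′u wu)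
      ... | no ¬wu = inj₁ (iu , ¬wu)

    -- Every pair of indices at distance two other than `j`, `j + 2` contains `j + 3` or `j + 4`, so
    -- all other non-exceptional vertices lie in two neighbourhoods of size `d`.
    n≤between : ∀ j → n ≤ # (between? j) + (β + (d + d))
    n≤between j = begin
      n                                        ≡⟨ sym (#-full everything? λ _ → tt) ⟩
      # everything?                            ≤⟨ #-⊎ everything? (between? j) rest? covered ⟩
      # (between? j) + # rest?                 ≤⟨ +-monoʳ-≤ (# (between? j)) (≤-trans
            (#-⊎ rest? exceptional? rest′? (λ _ → id)) (+-monoʳ-≤ β (≤-trans
            (#-⊎ rest′? (adj? G (c j₃)) (adj? G (c j₄)) (λ _ → id))
            (≤-reflexive (cong₂ _+_ (nbhd _) (nbhd _)))))) ⟩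
      # (between? j) + (β + (d + d))           ∎
      where
      open ≤-Reasoning
      everything? : Decidable (λ (_ : Fin n) → ⊤)
      everything? _ = yes tt

      j₃ = next (next (next j))
      j₄ = next j₃

      rest′? : Decidable (λ u → Adj G (c j₃) u ⊎ Adj G (c j₄) u)
      rest′? u = adj? G (c j₃) u ⊎-dec adj? G (c j₄) u

      rest? : Decidable (λ u → Exceptional u ⊎ (Adj G (c j₃) u ⊎ Adj G (c j₄) u))
      rest? u = exceptional? u ⊎-dec rest′? u

      covered : ∀ u → ⊤ → Between j u ⊎ (Exceptional u ⊎ (Adj G (c j₃) u ⊎ Adj G (c j₄) u))
      covered u _ with any? (λ i → between? i u)
      ... | no exc = inj₂ (inj₁ exc)
      ... | yes (i , iu , i²u) = case i iu i²u (relative i j)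
        where
        case : ∀ i → Adj G (c i) u → Adj G (c (next (next i))) u →
          (i ≡ j) ⊎ (j ≡ next i) ⊎ (i ≡ next j) ⊎ (j ≡ next (next i)) ⊎ (i ≡ next (next j)) → _
        case i iu i²u (inj₁ refl) = inj₁ (iu , i²u)
        case i iu i²u (inj₂ (inj₁ refl)) = inj₂ (inj₂ (inj₂ (subst (λ k → Adj G (c k) u) (sym (next⁵ i)) iu)))
        case i iu i²u (inj₂ (inj₂ (inj₁ refl))) = inj₂ (inj₂ (inj₁ i²u))
        case i iu i²u (inj₂ (inj₂ (inj₂ (inj₁ refl)))) = inj₂ (inj₂ (inj₁ (subst (λ k → Adj G (c k) u) (sym (next⁵ i)) iu)))
        case i iu i²u (inj₂ (inj₂ (inj₂ (inj₂ refl)))) = inj₂ (inj₂ (inj₂ i²u))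

  -- An edge between vertices of types i and i′ leaves `c i` and `c i′` at most 8β common
  -- neighbours. Equal indices have `d` of them and indices at distance two at least n - β - 2d, so
  -- both are excluded and the types are consecutive.
  homomorphism-to-C₅ : β * 8 < d → β * 9 + d * 2 < n → Σ (Fin n → Fin 5) λ part → G ⊆ᴱ blowUp C₅ part
  homomorphism-to-C₅ 8β<d 9β+2d<n = part , hom
    where
    part : Fin n → Fin 5
    part w = proj₁ (type w)

    8β : (β + (β + (β + β))) + (β + (β + (β + β))) ≡ β * 8
    8β = solve 1 (λ b → (b :+ (b :+ (b :+ b))) :+ (b :+ (b :+ (b :+ b))) := b :* con 8) refl β

    not-same : ∀ {w w′ i} → Type w i → Type w′ i → ¬ Adj G w w′
    not-same {i = i} t t′ a = n≮n d (≤-<-trans (begin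
      d                                               ≡⟨ sym (nbhd (c i)) ⟩
      # (adj? G (c i))                                ≤⟨ #-mono (adj? G (c i)) (λ u → adj? G (c i) u ×-dec adj? G (c i) u) (λ u x → x , x) ⟩
      # (λ u → adj? G (c i) u ×-dec adj? G (c i) u)   ≤⟨ common-≤ t t′ a ⟩
      _                                               ≡⟨ 8β ⟩
      β * 8                                           ∎) 8β<d)
      where open ≤-Reasoning

    not-opposite : ∀ {w w′ i} → Type w i → Type w′ (next (next i)) → ¬ Adj G w w′
    not-opposite {i = i} t t′ a = n≮n n (≤-<-trans (begin
      n                                               ≤⟨ n≤between i ⟩
      # (between? i) + (β + (d + d))                  ≤⟨ +-monoˡ-≤ (β + (d + d)) (common-≤ t t′ a) ⟩
      _                                               ≡⟨ cong (_+ (β + (d + d))) 8β ⟩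
      β * 8 + (β + (d + d))                           ≡⟨ solve 2 (λ b d → b :* con 8 :+ (b :+ (d :+ d))
          := b :* con 9 :+ d :* con 2) refl β d ⟩
      β * 9 + d * 2                                   ∎) 9β+2d<n)
      where open ≤-Reasoning

    hom : ∀ u v → Adj G u v → Adj C₅ (part u) (part v)
    hom u v a with type u | type v
    ... | i , t | j , t′ with relative i j
    ...   | inj₁ refl = contradiction a (not-same t t′)
    ...   | inj₂ (inj₁ refl) = next-Adj i
    ...   | inj₂ (inj₂ (inj₁ refl)) = adj-sym C₅ (next-Adj j)
    ...   | inj₂ (inj₂ (inj₂ (inj₁ refl))) = contradiction a (not-opposite t t′)
    ...   | inj₂ (inj₂ (inj₂ (inj₂ refl))) = contradiction (adj-sym G a) (not-opposite t′ t)

-- Regular bipartite graphs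

n≡#true+#false : (s : Fin n → Bool) → n ≡ # (λ u → s u Bool.≟ true) + # (λ u → s u Bool.≟ false)
n≡#true+#false {n} s = trans (sym (trans (sum-const n 1) (*-identityʳ n)))
  (trans (sum-cong-≗ pointwise) (∑-distrib-+ (λ u → ⟦ s u Bool.≟ true ⟧) λ u → ⟦ s u Bool.≟ false ⟧))
  where
  pointwise : ∀ u → 1 ≡ ⟦ s u Bool.≟ true ⟧ + ⟦ s u Bool.≟ false ⟧
  pointwise u with s u
  ... | true  = refl
  ... | false = refl

-- Multiplied by d, both sides of the equation count the edges.
regular-bipartite⇒balanced : (G : Graph n) ((s , _) : Bipartite G) → ∀ {d} .⦃ _ : NonZero d ⦄ →
  (∀ v → degree G v ≡ d) → # (λ u → s u Bool.≟ true) ≡ # (λ u → s u Bool.≟ false)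
regular-bipartite⇒balanced {n} G (s , proper) {d} deg = *-cancelʳ-≡ _ _ d (begin
  # (λ u → s u Bool.≟ true) * d                     ≡⟨ sym (sum-*ʳ (λ u → ⟦ s u Bool.≟ true ⟧) d) ⟩
  sum (λ u → ⟦ s u Bool.≟ true ⟧ * d)               ≡⟨ sum-cong-≗ (λ u → sym (row u)) ⟩
  sum (λ u → sum λ v → ⟦ edge? u v ⟧)               ≡⟨ ∑-comm (λ u v → ⟦ edge? u v ⟧) ⟩
  sum (λ v → sum λ u → ⟦ edge? u v ⟧)               ≡⟨ sum-cong-≗ column ⟩
  sum (λ v → ⟦ s v Bool.≟ false ⟧ * d)              ≡⟨ sum-*ʳ (λ v → ⟦ s v Bool.≟ false ⟧) d ⟩
  # (λ u → s u Bool.≟ false) * d                    ∎)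
  where
  open ≡-Reasoning

  edge? : ∀ u v → Dec (s u ≡ true × Adj G u v)
  edge? u v = (s u Bool.≟ true) ×-dec adj? G u v

  nbhd : ∀ u → # (adj? G u) ≡ 1 * d
  nbhd u = trans (trans (sym (degree≡# G u)) (deg u)) (sym (*-identityˡ d))

  row : ∀ u → # (λ v → edge? u v) ≡ ⟦ s u Bool.≟ true ⟧ * d
  row u with s u Bool.≟ true
  ... | yes e = trans (#-cong (λ v → yes e ×-dec adj? G u v) (adj? G u) (λ _ → proj₂) (λ _ a → e , a)) (nbhd u)
  ... | no ¬e = #-zero (λ v → no ¬e ×-dec adj? G u v) λ _ (e , _) → ¬e e

  column : ∀ v → # (λ u → edge? u v) ≡ ⟦ s v Bool.≟ false ⟧ * d
  column v with s v Bool.≟ false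
  ... | yes e = trans (#-cong (λ u → edge? u v) (adj? G v) (λ _ (_ , a) → adj-sym G a)
                  (λ u a → Bool.¬-not (λ e′ → proper v u a (trans e (sym e′))) , adj-sym G a)) (nbhd v)
  ... | no ¬e = #-zero (λ u → edge? u v) λ u (e , a) → proper u v a (trans e (sym (Bool.¬-not (λ e′ → ¬e e′))))

regular-bipartite⇒even : (G : Graph n) → Bipartite G → ∀ {d} .⦃ _ : NonZero d ⦄ →
  (∀ v → degree G v ≡ d) → 2 ∣ n
regular-bipartite⇒even G (s , proper) deg = divides X (trans (n≡#true+#false s)
  (trans (cong (X +_) (sym (regular-bipartite⇒balanced G (s , proper) deg)))
    (trans (cong (X +_) (sym (+-identityʳ X))) (*-comm 2 X))))
  where
  X = # (λ u → s u Bool.≟ true)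

rank : {P : Pred (Fin n) p} → Decidable P → Fin n → ℕ
rank P? u = # (λ v → P? v ×-dec (v Fin.<? u))

rank<# : {P : Pred (Fin n) p} (P? : Decidable P) → ∀ {u} → P u → rank P? u < # P?
rank<# P? {u} pu = #-mono-< (λ v → P? v ×-dec (v Fin.<? u)) P? (λ _ → proj₁) u pu λ (_ , u<u) → <-irrefl refl u<u

rank-mono-< : {P : Pred (Fin n) p} (P? : Decidable P) → ∀ {u v} → P u → u Fin.< v → rank P? u < rank P? v
rank-mono-< P? {u} {v} pu u<v = #-mono-< (λ w → P? w ×-dec (w Fin.<? u)) (λ w → P? w ×-dec (w Fin.<? v))
  (λ w (pw , w<u) → pw , <-trans w<u u<v) u (pu , u<v) λ (_ , u<u) → <-irrefl refl u<u

rank-injective : {P : Pred (Fin n) p} (P? : Decidable P) → ∀ {u v} → P u → P v → rank P? u ≡ rank P? v → u ≡ v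
rank-injective P? {u} {v} pu pv e with Fin.<-cmp u v
... | tri< u<v _ _ = contradiction e (<⇒≢ (rank-mono-< P? pu u<v))
... | tri≈ _ u≡v _ = u≡v
... | tri> _ _ v<u = contradiction (sym e) (<⇒≢ (rank-mono-< P? pv v<u))

T₂-side : ∀ n → Fin n → Bool
T₂-side n v = does (toℕ v <? ⌊ n /2⌋)

⌊n+n/2⌋≡n : ∀ n → ⌊ n + n /2⌋ ≡ n
⌊n+n/2⌋≡n n = sym (n≡⌊n+n/2⌋ n)

balanced⇒embeds-in-T₂ : (G : Graph n) ((s , _) : Bipartite G) →
  # (λ u → s u Bool.≟ true) ≡ # (λ u → s u Bool.≟ false) → ∃ (IsEmbedding G (T₂ n))
balanced⇒embeds-in-T₂ {n} G (s , proper) balanced = π , (λ {u} {v} → π-injective u v) , π-hom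
  where
  true? = λ u → s u Bool.≟ true
  false? = λ u → s u Bool.≟ false
  m = # true?

  n≡m+m : n ≡ m + m
  n≡m+m = trans (n≡#true+#false s) (cong (m +_) (sym balanced))

  ⌊n/2⌋≡m : ⌊ n /2⌋ ≡ m
  ⌊n/2⌋≡m = trans (cong ⌊_/2⌋ n≡m+m) (⌊n+n/2⌋≡n m)

  -- The two sides of `G` need not be initial and final segments of the vertices; listing one side
  -- before the other moves them to the parts of `T₂`.
  position : ∀ u → Dec (s u ≡ true) → ℕ
  position u (yes _) = rank true? u
  position u (no _)  = m + rank false? u

  position<n : ∀ u t → position u t < n
  position<n u (yes e) = <-≤-trans (rank<# true? e) (≤-trans (m≤m+n m m) (≤-reflexive (sym n≡m+m)))
  position<n u (no ¬e) = <-≤-trans (+-monoʳ-< m (rank<# false? (Bool.¬-not ¬e)))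
    (≤-reflexive (sym (n≡#true+#false s)))

  π : Fin n → Fin n
  π u = fromℕ< (position<n u (true? u))

  toℕ-π : ∀ u → toℕ (π u) ≡ position u (true? u)
  toℕ-π u = Fin.toℕ-fromℕ< (position<n u (true? u))

  side-position : ∀ u t → does (position u t <? ⌊ n /2⌋) ≡ s u
  side-position u (yes e) = trans (dec-true (rank true? u <? _) (<-≤-trans (rank<# true? e) (≤-reflexive (sym ⌊n/2⌋≡m)))) (sym e)
  side-position u (no ¬e) = trans (dec-false (m + rank false? u <? _)
    (≤⇒≯ (≤-trans (≤-reflexive ⌊n/2⌋≡m) (m≤m+n m _)))) (sym (Bool.¬-not ¬e))

  side-π : ∀ u → T₂-side n (π u) ≡ s u
  side-π u = trans (cong (λ i → does (i <? ⌊ n /2⌋)) (toℕ-π u)) (side-position u (true? u))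

  π-hom : ∀ u v → Adj G u v → T₂-side n (π u) ≢ T₂-side n (π v)
  π-hom u v a e = proper u v a (trans (sym (side-π u)) (trans e (side-π v)))

  position-injective : ∀ u v t t′ → s u ≡ s v → position u t ≡ position v t′ → u ≡ v
  position-injective u v (yes e) (yes e′) _ p = rank-injective true? e e′ p
  position-injective u v (no e)  (no e′)  _ p = rank-injective false? (Bool.¬-not e) (Bool.¬-not e′) (+-cancelˡ-≡ m _ _ p)
  position-injective u v (yes e) (no ¬e′) q _ = contradiction (trans (sym q) e) ¬e′
  position-injective u v (no ¬e) (yes e′) q _ = contradiction (trans q e′) ¬e

  π-injective : ∀ u v → π u ≡ π v → u ≡ v
  π-injective u v e = position-injective u v (true? u) (true? v)
    (trans (sym (side-π u)) (trans (cong (T₂-side n) e) (side-π v)))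
    (trans (sym (toℕ-π u)) (trans (cong toℕ e) (toℕ-π v)))

#-toℕ< : ∀ {m} → m ≤ n → # (λ (u : Fin n) → toℕ u <? m) ≡ m
#-toℕ< {n} {zero} _ = #-zero (λ (u : Fin n) → toℕ u <? 0) λ _ ()
#-toℕ< {suc n} {suc m} (s≤s m≤n) = cong suc (trans
  (#-cong (λ (u : Fin n) → suc (toℕ u) <? suc m) (λ u → toℕ u <? m) (λ _ → ≤-pred) (λ _ → s≤s)) (#-toℕ< m≤n))

T₂-bipartite : ∀ n → Bipartite (T₂ n)
T₂-bipartite n = T₂-side n , λ _ _ → id

T₂-degree : ∀ m v → degree (T₂ (m + m)) v ≡ m
T₂-degree m v = trans (degree≡# (T₂ n′) v) (opposite (side v) refl)
  where
  n′ = m + m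
  side = T₂-side n′

  does⇒ : ∀ {A : Set} (a : Dec A) → does a ≡ true → A
  does⇒ (yes x) _ = x

  #true : # (λ u → side u Bool.≟ true) ≡ m
  #true = trans (#-cong (λ u → side u Bool.≟ true) (λ u → toℕ u <? m)
      (λ u e → subst (toℕ u <_) (⌊n+n/2⌋≡n m) (does⇒ (toℕ u <? ⌊ n′ /2⌋) e))
      (λ u u<m → dec-true (toℕ u <? ⌊ n′ /2⌋) (subst (toℕ u <_) (sym (⌊n+n/2⌋≡n m)) u<m)))
    (#-toℕ< (m≤m+n m m))

  #false : # (λ u → side u Bool.≟ false) ≡ m
  #false = +-cancelˡ-≡ m _ _ (trans (cong (_+ # (λ u → side u Bool.≟ false)) (sym #true)) (sym (n≡#true+#false side)))

  opposite : ∀ b → side v ≡ b → # (adj? (T₂ n′) v) ≡ m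
  opposite true  e = trans (#-cong (adj? (T₂ n′) v) (λ u → side u Bool.≟ false)
    (λ u a → Bool.¬-not (λ e′ → a (trans e (sym e′)))) (λ u e′ p → contradiction (trans (sym e) (trans p e′)) λ ())) #false
  opposite false e = trans (#-cong (adj? (T₂ n′) v) (λ u → side u Bool.≟ true)
    (λ u a → Bool.¬-not (λ e′ → a (trans e (sym e′)))) (λ u e′ p → contradiction (trans (sym e) (trans p e′)) λ ())) #true

-- A dense regular subgraph of a blow-up of C₅

sum-↑ : ∀ a b (f : Fin (a + b) → ℕ) → sum f ≡ sum (f ∘ (_↑ˡ b)) + sum (f ∘ (a ↑ʳ_))
sum-↑ zero    b f = refl
sum-↑ (suc a) b f = trans (cong (f zero +_) (sum-↑ a b (f ∘ suc))) (sym (+-assoc (f zero) _ _))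

sum-combine : ∀ a b (f : Fin (a * b) → ℕ) → sum f ≡ sum (λ i → sum λ j → f (combine {a} {b} i j))
sum-combine zero    b f = refl
sum-combine (suc a) b f = trans (sum-↑ b (a * b) f)
  (cong (sum (λ j → f (j ↑ˡ (a * b))) +_) (sum-combine a b (f ∘ (b ↑ʳ_))))

-- Adding `x` permutes the residues. Induction on `x` reduces this to a rotation by one, which moves
-- the term at 0 to the end.
sum-shift : ∀ m (F : ℕ → ℕ) x → sum (λ (y : Fin (suc m)) → F ((x + toℕ y) % suc m)) ≡ sum (λ (y : Fin (suc m)) → F (toℕ y))
sum-shift m F zero = sum-cong-≗ λ y → cong F (m<n⇒m%n≡m {suc m} {toℕ y} (Fin.toℕ<n y))
sum-shift m F (suc x) = begin
  sum (λ (y : Fin (suc m)) → F (suc (x + toℕ y) % suc m))          ≡⟨ sum-cong-≗ {suc m} (λ y → cong F (sym (suc-% (x + toℕ y)))) ⟩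
  sum (λ (y : Fin (suc m)) → F (suc ((x + toℕ y) % suc m) % suc m)) ≡⟨ sum-shift m (λ k → F (suc k % suc m)) x ⟩
  sum (λ (y : Fin (suc m)) → F (suc (toℕ y) % suc m))              ≡⟨ sum-init-last (λ (y : Fin (suc m)) → F (suc (toℕ y) % suc m)) ⟩
  sum (λ (y : Fin m) → F (suc (toℕ (inject₁ y)) % suc m)) + F (suc (toℕ (fromℕ m)) % suc m)
    ≡⟨ cong₂ _+_ (sum-cong-≗ λ y → cong F (trans (cong (λ k → suc k % suc m) (Fin.toℕ-inject₁ y))
                   (m<n⇒m%n≡m {suc m} {suc (toℕ y)} (s≤s (Fin.toℕ<n y)))))
                 (cong F (trans (cong (λ k → suc k % suc m) (Fin.toℕ-fromℕ m)) (n%n≡0 (suc m)))) ⟩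
  sum (λ (y : Fin m) → F (suc (toℕ y))) + F 0                      ≡⟨ +-comm _ (F 0) ⟩
  sum (λ (y : Fin (suc m)) → F (toℕ y))                            ∎
  where
  open ≡-Reasoning
  suc-% : ∀ k → suc (k % suc m) % suc m ≡ suc k % suc m
  suc-% k = trans (%-distribˡ-+ 1 (k % suc m) (suc m))
    (trans (cong (λ r → (1 % suc m + r) % suc m) (m%n%n≡m%n k (suc m))) (sym (%-distribˡ-+ 1 k (suc m))))

C₅-triangleFree : TriangleFree C₅
C₅-triangleFree = toWitness {a? = Fin.all? λ u → Fin.all? λ v → Fin.all? λ w →
  adj? C₅ u v →-dec adj? C₅ v w →-dec ¬? (adj? C₅ u w)} _

deletedBlowUp-triangleFree : (G : Graph n) → DeletedBlowUp C₅ G → TriangleFree G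
deletedBlowUp-triangleFree G (part , _ , ⊆) u v w uv vw uw = C₅-triangleFree _ _ _ (⊆ _ _ uv) (⊆ _ _ vw) (⊆ _ _ uw)

-- Five classes of order m = m′ + 1 are joined cyclically, completely (just true)
-- or up to a j-regular bipartite graph (just false).  Two further classes of
-- order j are joined completely to the neighbours among the five classes of the
-- classes 0 and 1, respectively, but not to each other.
module Example (m′ j : ℕ) (j≤m : j ≤ suc m′) where

  private
    m = suc m′

  order : ℕ
  order = 5 * m + 2 * j

  Label : Set
  Label = (Fin 5 × Fin m) ⊎ (Fin 2 × Fin j)

  label : Fin order → Label
  label v = Sum.map (remQuot m) (remQuot j) (splitAt (5 * m) v)

  -- The class twin to 0 is joined to classes 1 and 4, the one twin to 1 to classes 0 and 2. Thus
  -- classes 0, 1, 2 and 4 gain `j` in degree, and thinning the pairs 1, 2 and 4, 0, which cover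
  -- each of them once, restores degree 2m. Class 3 gains nothing and stays complete to 2 and 4.
  link : Fin 5 → Fin 5 → Maybe Bool
  link zero                         (suc zero)                   = just true
  link (suc zero)                   zero                         = just true
  link (suc zero)                   (suc (suc zero))             = just false
  link (suc (suc zero))             (suc zero)                   = just false
  link (suc (suc zero))             (suc (suc (suc zero)))       = just true
  link (suc (suc (suc zero)))       (suc (suc zero))             = just true
  link (suc (suc (suc zero)))       (suc (suc (suc (suc zero)))) = just true
  link (suc (suc (suc (suc zero)))) (suc (suc (suc zero)))       = just true
  link (suc (suc (suc (suc zero)))) zero                         = just false
  link zero                         (suc (suc (suc (suc zero)))) = just false
  link _                            _                            = nothing

  private
    link-sym : ∀ a b → link a b ≡ link b a
    link-sym = toWitness {a? = Fin.all? λ a → Fin.all? λ b → Maybe.≡-dec Bool._≟_ (link a b) (link b a)} _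

    link-irrefl : ∀ a → link a a ≡ nothing
    link-irrefl = toWitness {a? = Fin.all? λ a → Maybe.≡-dec Bool._≟_ (link a a) nothing} _

    link-C₅ : ∀ a b → link a b ≢ nothing → Adj C₅ a b
    link-C₅ = toWitness {a? = Fin.all? λ a → Fin.all? λ b →
      ¬? (Maybe.≡-dec Bool._≟_ (link a b) nothing) →-dec adj? C₅ a b} _

  -- In a thinned pair each `x` loses the `j` vertices `y` with (x + y) mod m below `j`. A sum,
  -- unlike a difference, makes the condition symmetric.
  Joined : Maybe Bool → Fin m → Fin m → Set
  Joined nothing      x y = ⊥
  Joined (just true)  x y = ⊤
  Joined (just false) x y = j ≤ (toℕ x + toℕ y) % m

  joined? : ∀ l x y → Dec (Joined l x y)
  joined? nothing      x y = no λ ()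
  joined? (just true)  x y = yes tt
  joined? (just false) x y = j ≤? (toℕ x + toℕ y) % m

  joined-sym : ∀ l {x y} → Joined l x y → Joined l y x
  joined-sym (just true)          _ = tt
  joined-sym (just false) {x} {y} p = subst (λ s → j ≤ s % m) (+-comm (toℕ x) (toℕ y)) p

  twin : Fin 2 → Fin 5
  twin b = b ↑ˡ 3

  AdjL : Label → Label → Set
  AdjL (inj₁ (a , x)) (inj₁ (b , y)) = Joined (link a b) x y
  AdjL (inj₁ (a , _)) (inj₂ (b , _)) = Adj C₅ a (twin b)
  AdjL (inj₂ (a , _)) (inj₁ (b , _)) = Adj C₅ (twin a) b
  AdjL (inj₂ _)       (inj₂ _)       = ⊥

  adjL? : ∀ k l → Dec (AdjL k l)
  adjL? (inj₁ (a , x)) (inj₁ (b , y)) = joined? (link a b) x y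
  adjL? (inj₁ (a , _)) (inj₂ (b , _)) = adj? C₅ a (twin b)
  adjL? (inj₂ (a , _)) (inj₁ (b , _)) = adj? C₅ (twin a) b
  adjL? (inj₂ _)       (inj₂ _)       = no λ ()

  adjL-sym : ∀ k l → AdjL k l → AdjL l k
  adjL-sym (inj₁ (a , x)) (inj₁ (b , y)) p = subst (λ l → Joined l y x) (link-sym a b) (joined-sym (link a b) p)
  adjL-sym (inj₁ _)       (inj₂ _)       p = adj-sym C₅ p
  adjL-sym (inj₂ _)       (inj₁ _)       p = adj-sym C₅ p

  adjL-irrefl : ∀ k → ¬ AdjL k k
  adjL-irrefl (inj₁ (a , x)) p = subst (λ l → Joined l x x) (link-irrefl a) p

  graph : Graph order
  graph = record
    { Adj        = λ u v → AdjL (label u) (label v)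
    ; adj?       = λ u v → adjL? (label u) (label v)
    ; adj-sym    = λ {u} {v} → adjL-sym (label u) (label v)
    ; adj-irrefl = λ { {u} refl → adjL-irrefl (label u) }
    }

  partL : Label → Fin 5
  partL (inj₁ (a , _)) = a
  partL (inj₂ (b , _)) = twin b

  private
    adjL-part : ∀ k l → AdjL k l → Adj C₅ (partL k) (partL l)
    adjL-part (inj₁ (a , x)) (inj₁ (b , y)) p = link-C₅ a b λ e → subst (λ l → Joined l x y) e p
    adjL-part (inj₁ _)       (inj₂ _)       p = p
    adjL-part (inj₂ _)       (inj₁ _)       p = p

    label-class : ∀ a x → label (combine a x ↑ˡ (2 * j)) ≡ inj₁ (a , x)
    label-class a x = trans (cong (Sum.map (remQuot m) (remQuot j)) (Fin.splitAt-↑ˡ (5 * m) (combine a x) (2 * j)))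
      (cong inj₁ (Fin.remQuot-combine a x))

    label-twin : ∀ b y → label ((5 * m) ↑ʳ combine b y) ≡ inj₂ (b , y)
    label-twin b y = trans (cong (Sum.map (remQuot m) (remQuot j)) (Fin.splitAt-↑ʳ (5 * m) (2 * j) (combine b y)))
      (cong inj₂ (Fin.remQuot-combine b y))

  deletedBlowUp : DeletedBlowUp C₅ graph
  deletedBlowUp = partL ∘ label ,
    (λ a → combine {5} {m} a zero ↑ˡ (2 * j) , cong partL (label-class a zero)) ,
    λ u v → adjL-part (label u) (label v)

  private
    sum-label : (g : Label → ℕ) → sum (g ∘ label) ≡
      sum (λ a → sum λ x → g (inj₁ (a , x))) + sum (λ b → sum λ y → g (inj₂ (b , y)))
    sum-label g = trans (sum-↑ (5 * m) (2 * j) (g ∘ label)) (cong₂ _+_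
      (trans (sum-combine 5 m (g ∘ label ∘ (_↑ˡ (2 * j))))
        (sum-cong-≗ λ a → sum-cong-≗ λ x → cong g (label-class a x)))
      (trans (sum-combine 2 j (g ∘ label ∘ ((5 * m) ↑ʳ_)))
        (sum-cong-≗ λ b → sum-cong-≗ λ y → cong g (label-twin b y))))

    size : Maybe Bool → ℕ
    size nothing      = 0
    size (just true)  = m
    size (just false) = m ∸ j

    #-joined : ∀ l x → # (joined? l x) ≡ size l
    #-joined nothing      x = #-zero (joined? nothing x) λ _ ()
    #-joined (just true)  x = #-full (joined? (just true) x) λ _ → tt
    #-joined (just false) x = begin
      # (joined? (just false) x)             ≡⟨ sum-shift m′ (λ k → ⟦ j ≤? k ⟧) (toℕ x) ⟩
      # (λ (y : Fin m) → j ≤? toℕ y)         ≡⟨ #-cong (λ (y : Fin m) → j ≤? toℕ y) (λ y → ¬? (toℕ y <? j)) (λ _ → ≤⇒≯) (λ _ → ≮⇒≥) ⟩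
      # (λ (y : Fin m) → ¬? (toℕ y <? j))    ≡⟨ sym (m+n∸m≡n j _) ⟩
      j + # (λ (y : Fin m) → ¬? (toℕ y <? j)) ∸ j ≡⟨ cong (_∸ j) complement ⟩
      m ∸ j                                  ∎
      where
      open ≡-Reasoning
      below? : Decidable (λ (y : Fin m) → toℕ y < j)
      below? y = toℕ y <? j

      everything? : Decidable (λ (_ : Fin m) → ⊤)
      everything? _ = yes tt

      complement : j + # (λ y → ¬? (below? y)) ≡ m
      complement = begin
        j + # (λ y → ¬? (below? y))                ≡⟨ cong₂ _+_
          (trans (sym (#-toℕ< j≤m)) (#-cong below? (λ y → everything? y ×-dec below? y) (λ _ → tt ,_) (λ _ → proj₂)))
          (#-cong (λ y → ¬? (below? y)) (λ y → everything? y ×-dec ¬? (below? y)) (λ _ → tt ,_) (λ _ → proj₂)) ⟩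
        # (λ y → everything? y ×-dec below? y) + # (λ y → everything? y ×-dec ¬? (below? y)) ≡⟨ sym (#-split everything? below?) ⟩
        # everything?                              ≡⟨ #-full everything? (λ _ → tt) ⟩
        m                                          ∎

    degreeL : ∀ k → sum (λ a → sum λ x → ⟦ adjL? k (inj₁ (a , x)) ⟧) +
                    sum (λ b → sum λ y → ⟦ adjL? k (inj₂ (b , y)) ⟧) ≡ m * 2
    degreeL (inj₁ (a , x)) = trans (cong₂ _+_ (sum-cong-≗ λ b → #-joined (link a b) x)
      (sum-cong-≗ λ b → sum-const j ⟦ adj? C₅ a (twin b) ⟧)) (total a)
      where
      r′ = m ∸ j

      m+r+j : m + (r′ + j) ≡ m * 2
      m+r+j = trans (cong (m +_) (m∸n+n≡m j≤m)) (solve 1 (λ m → m :+ m := m :* con 2) refl m)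

      total : ∀ a → sum (λ b → size (link a b)) + sum (λ b → j * ⟦ adj? C₅ a (twin b) ⟧) ≡ m * 2
      total zero = trans (solve 3 (λ m r j → (m :+ (r :+ con 0)) :+ (j :* con 0 :+ (j :* con 1 :+ con 0))
        := m :+ (r :+ j)) refl m r′ j) m+r+j
      total (suc zero) = trans (solve 3 (λ m r j → (m :+ (r :+ con 0)) :+ (j :* con 1 :+ (j :* con 0 :+ con 0))
        := m :+ (r :+ j)) refl m r′ j) m+r+j
      total (suc (suc zero)) = trans (solve 3 (λ m r j → (r :+ (m :+ con 0)) :+ (j :* con 0 :+ (j :* con 1 :+ con 0))
        := m :+ (r :+ j)) refl m r′ j) m+r+j
      total (suc (suc (suc zero))) = solve 2 (λ m j → (m :+ (m :+ con 0)) :+ (j :* con 0 :+ (j :* con 0 :+ con 0))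
        := m :* con 2) refl m j
      total (suc (suc (suc (suc zero)))) = trans (solve 3 (λ m r j → (r :+ (m :+ con 0)) :+ (j :* con 1 :+ (j :* con 0 :+ con 0))
        := m :+ (r :+ j)) refl m r′ j) m+r+j
    degreeL (inj₂ (b , y)) = trans (cong₂ _+_ (sum-cong-≗ λ a → sum-const m ⟦ adj? C₅ (twin b) a ⟧)
      (sum-cong-≗ {2} λ _ → sum-const j 0)) (total b)
      where
      total : ∀ b → sum (λ a → m * ⟦ adj? C₅ (twin b) a ⟧) + (j * 0 + (j * 0 + 0)) ≡ m * 2
      total zero = solve 2 (λ m j → (m :* con 0 :+ (m :* con 1 :+ (m :* con 0 :+ (m :* con 0 :+ (m :* con 1 :+ con 0))))) :+ (j :* con 0 :+ (j :* con 0 :+ con 0))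
        := m :* con 2) refl m j
      total (suc zero) = solve 2 (λ m j → (m :* con 1 :+ (m :* con 0 :+ (m :* con 1 :+ (m :* con 0 :+ (m :* con 0 :+ con 0))))) :+ (j :* con 0 :+ (j :* con 0 :+ con 0))
        := m :* con 2) refl m j

  graph-degree : ∀ v → degree graph v ≡ m * 2
  graph-degree v = trans (degree≡# graph v) (trans (sum-label (λ l → ⟦ adjL? (label v) l ⟧)) (degreeL (label v)))

-- The maximum number of copies

𝒩-mono-⊆ᴱ : (H : Graph h) (G G′ : Graph n) → G ⊆ᴱ G′ → 𝒩 H G ≤ 𝒩 H G′
𝒩-mono-⊆ᴱ H G G′ ⊆ = 𝒩-mono H G G′ (embeddings-mono H G G′ id (id , ⊆))

⊆ᴱ-degree : (G G′ : Graph n) → G ⊆ᴱ G′ → ∀ v → degree G v ≤ degree G′ v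
⊆ᴱ-degree G G′ ⊆ v = subst₂ _≤_ (sym (degree≡# G v)) (sym (degree≡# G′ v)) (#-mono (adj? G v) (adj? G′ v) (⊆ v))

-- Codes are 0/1 matrices; symmetry and irreflexivity are imposed here, so every code yields a
-- graph. Since adjacency is an arbitrary relation, graphs are recovered from codes only up to
-- having the same edges, which is enough for degrees and copies.
decode : ∀ n → Fin (2 ^ (n * n)) → Graph n
decode n c = record
  { Adj        = λ u v → u ≢ v × entry u v ≡ suc zero × entry v u ≡ suc zero
  ; adj?       = λ u v → ¬? (u ≟ v) ×-dec (entry u v ≟ suc zero) ×-dec (entry v u ≟ suc zero)
  ; adj-sym    = λ (u≢v , uv , vu) → u≢v ∘ sym , vu , uv
  ; adj-irrefl = λ e (u≢v , _) → u≢v e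
  }
  where
  entry : Fin n → Fin n → Fin 2
  entry u v = finToFun {2} {n * n} c (combine u v)

encode : Graph n → Fin (2 ^ (n * n))
encode {n} G = funToFin {n * n} (bit ∘ uncurry (adj? G) ∘ remQuot {n} n)
  module Encode where
  bit : ∀ {P : Set} → Dec P → Fin 2
  bit (yes _) = suc zero
  bit (no _)  = zero

module _ (G : Graph n) where
  open Encode G

  private
    entry≡ : ∀ u v → finToFun {2} {n * n} (encode G) (combine u v) ≡ bit (adj? G u v)
    entry≡ u v = trans (Fin.finToFun-funToFin (bit ∘ uncurry (adj? G) ∘ remQuot {n} n) (combine u v))
      (cong (bit ∘ uncurry (adj? G)) (Fin.remQuot-combine u v))

    bit⁺ : ∀ {P : Set} (P? : Dec P) → P → bit P? ≡ suc zero
    bit⁺ (yes _) _ = refl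
    bit⁺ (no ¬p) p = contradiction p ¬p

    bit⁻ : ∀ {P : Set} (P? : Dec P) → bit P? ≡ suc zero → P
    bit⁻ (yes p) _ = p

  encode-⊆ : G ⊆ᴱ decode n (encode G)
  encode-⊆ u v a = (λ e → adj-irrefl G e a) , trans (entry≡ u v) (bit⁺ (adj? G u v) a) ,
    trans (entry≡ v u) (bit⁺ (adj? G v u) (adj-sym G a))

  encode-⊇ : decode n (encode G) ⊆ᴱ G
  encode-⊇ u v (_ , e , _) = bit⁻ (adj? G u v) (trans (sym (entry≡ u v)) e)

argmax : ∀ {N} {P : Pred (Fin N) 0ℓ} (P? : Decidable P) (f : Fin N → ℕ) → ∃ P →
  ∃ λ i → P i × ∀ j → P j → f j ≤ f i
argmax {suc N} P? f (i , p) with Fin.any? (P? ∘ suc)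
... | no ¬p with i
...   | zero  = zero , p , λ where
        zero    _ → ≤-refl
        (suc j) q → contradiction (j , q) ¬p
...   | suc i = contradiction (i , p) ¬p
argmax {suc N} P? f (i , p) | yes p′ with argmax (P? ∘ suc) (f ∘ suc) p′ | P? zero
... | j , q , max | no ¬p₀ = suc j , q , λ where
        zero    p₀ → contradiction p₀ ¬p₀
        (suc k) r  → max k r
... | j , q , max | yes p₀ with ≤-total (f zero) (f (suc j))
...   | inj₁ ≤₁ = suc j , q , λ where
        zero    _ → ≤₁
        (suc k) r → max k r
...   | inj₂ ≥₁ = zero , p₀ , λ where
        zero    _ → ≤-refl
        (suc k) r → ≤-trans (max k r) ≥₁

-- The maximum is attained because finitely many codes cover all graphs.
module _ (H : Graph h) (v₀ : Fin n) where

  private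
    -- Regularity is expressed by comparing degrees, without an unbounded existential, so that it
    -- can be decided; the common degree is later read off at `v₀`.
    Admissible : Fin (2 ^ (n * n)) → Set
    Admissible c = (∀ u v w → Adj (decode n c) u v → Adj (decode n c) v w → ¬ Adj (decode n c) u w) ×
                   (∀ u v → degree (decode n c) u ≡ degree (decode n c) v)

    admissible? : Decidable Admissible
    admissible? c =
      (Fin.all? λ u → Fin.all? λ v → Fin.all? λ w →
        adj? (decode n c) u v →-dec adj? (decode n c) v w →-dec ¬? (adj? (decode n c) u w))
      ×-dec (Fin.all? λ u → Fin.all? λ v → degree (decode n c) u ℕ.≟ degree (decode n c) v)

    admissible : ∀ G → TriangleFree G → ∀ {d} → (∀ v → degree G v ≡ d) → Admissible (encode G)
    admissible G free {d} deg =
      (λ u v w a b c → free u v w (encode-⊇ G u v a) (encode-⊇ G v w b) (encode-⊇ G u w c)) ,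
      λ u v → trans (same u) (sym (same v))
      where
      same : ∀ u → degree (decode n (encode G)) u ≡ d
      same u = trans (≤-antisym (⊆ᴱ-degree (decode n (encode G)) G (encode-⊇ G) u)
                                (⊆ᴱ-degree G (decode n (encode G)) (encode-⊆ G) u)) (deg u)

  maximiser : (G₀ : Graph n) → TriangleFree G₀ → Regular G₀ →
    Σ (Graph n) λ G → TriangleFree G × Regular G × (∀ (G′ : Graph n) → TriangleFree G′ → Regular G′ → 𝒩 H G′ ≤ 𝒩 H G)
  maximiser G₀ free₀ (_ , deg₀)
    with c , (free , reg) , max ← argmax admissible? (𝒩 H ∘ decode n) (encode G₀ , admissible G₀ free₀ deg₀)
    = decode n c , free , (degree (decode n c) v₀ , λ v → reg v v₀) ,
      λ { G′ free′ (_ , deg′) → ≤-trans (𝒩-mono-⊆ᴱ H G′ (decode n (encode G′)) (encode-⊆ G′))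
                                        (max (encode G′) (admissible G′ free′ deg′)) }

C₅-minus-vertex-bipartite : ∀ q → Σ (Fin 5 → Bool) λ side → ∀ a b → a ≢ q → b ≢ q → Adj C₅ a b → side a ≢ side b
C₅-minus-vertex-bipartite q = side q , toWitness {a? = Fin.all? λ q → Fin.all? λ a → Fin.all? λ b →
  ¬? (a ≟ q) →-dec ¬? (b ≟ q) →-dec adj? C₅ a b →-dec ¬? (side q a Bool.≟ side q b)} _ q
  where
  side : Fin 5 → Fin 5 → Bool
  side q a = does (a ≟ next q) ∨ does (a ≟ next (next (next q)))

-- A homomorphism missing a vertex of C₅ maps into a path on four vertices, and a 2-colouring of the
-- path pulls back to `G`.
homomorphism-surjective : (G : Graph n) (part : Fin n → Fin 5) → G ⊆ᴱ blowUp C₅ part → ¬ Bipartite G →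
  StrictlySurjective _≡_ part
homomorphism-surjective G part hom ¬bip q with Fin.any? (λ v → part v ≟ q)
... | yes e = e
... | no ¬e = let side , proper = C₅-minus-vertex-bipartite q in contradiction
  (side ∘ part , λ u v a → proper (part u) (part v) (λ e → ¬e (u , e)) (λ e → ¬e (v , e)) (hom u v a)) ¬bip

𝒩-≤-degree : (H : Graph h) (G G′ : Graph n) {d d′ : ℕ} → FreelyExtends H G′ →
  (∀ v → degree G v ≡ d) → (∀ v → degree G′ v ≡ d′) → d + h ≤ d′ → 𝒩 H G ≤ 𝒩 H G′
𝒩-≤-degree H G G′ free deg deg′ d+h≤d′ = 𝒩-mono H G G′
  (embeddings-≤-degree H G G′ d+h≤d′ (≤-reflexive ∘ deg) (≤-reflexive ∘ sym ∘ deg′) free)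

-- Even order: comparison with the balanced complete bipartite graph

module Even (H : Graph h) (bipartite : Bipartite H) {m : ℕ} (large : 10 * h < m + m) where

  5h<m : 5 * h < m
  5h<m = *-cancelˡ-< 2 (5 * h) m (subst₂ _<_ (solve 1 (λ h → con 10 :* h := con 2 :* (con 5 :* h)) refl h)
    (solve 1 (λ m → m :+ m := con 2 :* m) refl m) large)

  vertex : Fin (m + m)
  vertex = Fin.fromℕ< (≤-<-trans z≤n large)

  module _ (G : Graph (m + m)) (free : TriangleFree G) {d : ℕ} (deg : ∀ v → degree G v ≡ d) where

    private
      module _ (m<d+h : m < d + h) where

        d≢0 : NonZero d
        d≢0 = >-nonZero (n≢0⇒n>0 λ { refl → <-asym m<d+h (≤-<-trans (m≤m+n h _) 5h<m) })

        n<3d : m + m < d + (d + d)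
        n<3d = ≰⇒> λ 3d≤n → n≮n (3 * h) (≤-<-trans (m≤n+m (3 * h) (2 * h)) (begin-strict
          2 * h + 3 * h          ≡⟨ solve 1 (λ h → con 2 :* h :+ con 3 :* h := con 5 :* h) refl h ⟩
          5 * h                  <⟨ 5h<m ⟩
          m                      ≤⟨ +-cancelˡ-≤ (m + m) m (3 * h) (begin
            (m + m) + m            ≡⟨ solve 1 (λ m → (m :+ m) :+ m := con 3 :* m) refl m ⟩
            3 * m                  ≤⟨ *-monoʳ-≤ 3 (<⇒≤ m<d+h) ⟩
            3 * (d + h)            ≡⟨ solve 2 (λ d h → con 3 :* (d :+ h) := (d :+ (d :+ d)) :+ con 3 :* h) refl d h ⟩
            (d + (d + d)) + 3 * h  ≤⟨ +-monoˡ-≤ (3 * h) 3d≤n ⟩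
            (m + m) + 3 * h        ∎) ⟩
          3 * h                  ∎))
          where open ≤-Reasoning

        -- A closed walk gives 5d ≤ 2n = 4m; with m < d + h this yields m ≤ 5h. Here the threshold
        -- 10h on n = 2m is used in full.
        no-closedWalk₅ : ∀ c → ¬ ClosedWalk₅ G c
        no-closedWalk₅ c walk = n≮n m (≤-<-trans (+-cancelˡ-≤ (4 * m) m (5 * h) (begin
          4 * m + m              ≡⟨ solve 1 (λ m → con 4 :* m :+ m := con 5 :* m) refl m ⟩
          5 * m                  ≤⟨ *-monoʳ-≤ 5 (<⇒≤ m<d+h) ⟩
          5 * (d + h)            ≡⟨ *-distribˡ-+ 5 d h ⟩
          5 * d + 5 * h          ≤⟨ +-monoˡ-≤ (5 * h) (≤-trans (m≤n+m (5 * d) β) β+5d≤2n) ⟩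
          (m + m) * 2 + 5 * h    ≡⟨ cong (_+ 5 * h) (solve 1 (λ m → (m :+ m) :* con 2 := con 4 :* m) refl m) ⟩
          4 * m + 5 * h          ∎)) 5h<m)
          where
          open ≤-Reasoning
          open NearExtremal G free deg c walk

        embeds : ∃ (IsEmbedding G (T₂ (m + m)))
        embeds with closedWalk₅-or-bipartite G free vertex deg n<3d
        ... | inj₁ (c , walk) = contradiction walk (no-closedWalk₅ c)
        ... | inj₂ bip = balanced⇒embeds-in-T₂ G bip (regular-bipartite⇒balanced G bip ⦃ d≢0 ⦄ deg)

    𝒩≤𝒩T₂ : 𝒩 H G ≤ 𝒩 H (T₂ (m + m))
    𝒩≤𝒩T₂ with d + h ≤? m
    ... | yes d+h≤m = 𝒩-≤-degree H G (T₂ (m + m)) (bipartite-freelyExtends H bipartite) deg (T₂-degree m) d+h≤m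
    ... | no ¬d+h≤m with π , emb ← embeds (≰⇒> ¬d+h≤m) = 𝒩-mono H G (T₂ (m + m)) (embeddings-mono H G (T₂ (m + m)) π emb)

  isRex : IsRex (m + m) H (K 3) (𝒩 H (T₂ (m + m)))
  isRex = (T₂ (m + m) , triangleFree⇒K₃-free (T₂ (m + m)) (bipartite⇒triangleFree (T₂ (m + m)) (T₂-bipartite (m + m))) ,
            (m , T₂-degree m) , refl) ,
    λ { _ (G , free , (_ , deg) , refl) → 𝒩≤𝒩T₂ G (K₃-free⇒triangleFree G free) deg }

-- Odd order: constants and the choice of the extremal graph

five-two : ∀ k → ∃₂ λ m j → 24 + k ≡ 5 * m + 2 * j × j ≤ 4 × 4 ≤ m
-- As `j` runs from 0 to 4, 2j meets every residue modulo 5. The bound `4 ≤ m`, which later gives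
-- `j ≤ m`, excludes 23, so the induction starts at 24.
five-two 0 = 4 , 2 , refl , m≤m+n 2 2 , ≤-refl
five-two 1 = 5 , 0 , refl , z≤n , m≤m+n 4 1
five-two 2 = 4 , 3 , refl , m≤m+n 3 1 , ≤-refl
five-two 3 = 5 , 1 , refl , m≤m+n 1 3 , m≤m+n 4 1
five-two 4 = 4 , 4 , refl , ≤-refl , ≤-refl
five-two (suc (suc (suc (suc (suc k))))) with m , j , e , j≤4 , 4≤m ← five-two k =
  suc m , j , trans (cong (5 +_) e) (solve 2 (λ m j → con 5 :+ (con 5 :* m :+ con 2 :* j)
    := con 5 :* (con 1 :+ m) :+ con 2 :* j) refl m j) , j≤4 , m≤n⇒m≤1+n 4≤m

module _ {n : ℕ} (b d : ℕ) (2n≤5d+b : n * 2 ≤ 5 * d + b) (45b<n : 45 * b < n) where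

  open ≤-Reasoning

  8b<d : b * 8 < d
  8b<d = ≰⇒> λ d≤8b → n≮n (45 * b) (begin-strict
    45 * b            <⟨ 45b<n ⟩
    n                 ≤⟨ m≤m*n n 2 ⟩
    n * 2             ≤⟨ 2n≤5d+b ⟩
    5 * d + b         ≤⟨ +-monoˡ-≤ b (*-monoʳ-≤ 5 d≤8b) ⟩
    5 * (b * 8) + b   ≡⟨ solve 1 (λ b → con 5 :* (b :* con 8) :+ b := con 41 :* b) refl b ⟩
    41 * b            ≤⟨ *-monoˡ-≤ b (m≤m+n 41 4) ⟩
    45 * b            ∎)

  n<3d : n < d + (d + d)
  n<3d = ≰⇒> λ 3d≤n → n≮n d (begin-strict
    d                 ≤⟨ +-cancelˡ-≤ (5 * d) d b (begin
      5 * d + d         ≡⟨ solve 1 (λ d → con 5 :* d :+ d := (d :+ (d :+ d)) :* con 2) refl d ⟩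
      (d + (d + d)) * 2 ≤⟨ *-monoˡ-≤ 2 3d≤n ⟩
      n * 2             ≤⟨ 2n≤5d+b ⟩
      5 * d + b         ∎) ⟩
    b                 ≤⟨ m≤m*n b 8 ⟩
    b * 8             <⟨ 8b<d ⟩
    d                 ∎)

  module _ {β : ℕ} (β+5d≤2n : β + 5 * d ≤ n * 2) where

    -- The deficiency 2n - 5d is at least β by double counting and at most `b` by assumption.
    β≤b : β ≤ b
    β≤b = +-cancelʳ-≤ (5 * d) β b (≤-trans β+5d≤2n (≤-trans 2n≤5d+b (≤-reflexive (+-comm (5 * d) b))))

    8β<d : β * 8 < d
    8β<d = ≤-<-trans (*-monoˡ-≤ 8 β≤b) 8b<d

    -- Multiplied by five, the opposite inequality and 10d ≤ 4n leave n ≤ 45β. This is the origin of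
    -- the factor 45 in the threshold.
    9β+2d<n : β * 9 + d * 2 < n
    9β+2d<n = ≰⇒> λ n≤ → n≮n n (≤-<-trans (+-cancelʳ-≤ (n * 4) n (45 * b) (begin
      n + n * 4                  ≡⟨ solve 1 (λ n → n :+ n :* con 4 := con 5 :* n) refl n ⟩
      5 * n                      ≤⟨ *-monoʳ-≤ 5 n≤ ⟩
      5 * (β * 9 + d * 2)        ≡⟨ solve 2 (λ β d → con 5 :* (β :* con 9 :+ d :* con 2)
          := con 45 :* β :+ con 5 :* d :* con 2) refl β d ⟩
      45 * β + 5 * d * 2         ≤⟨ +-mono-≤ (*-monoʳ-≤ 45 β≤b) (*-monoˡ-≤ 2 (≤-trans (m≤n+m (5 * d) β) β+5d≤2n)) ⟩
      45 * b + n * 2 * 2         ≡⟨ cong (45 * b +_) (*-assoc n 2 2) ⟩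
      45 * b + n * 4             ∎)) 45b<n)

homomorphism⇒deletedBlowUp : (G : Graph n) → ¬ Bipartite G →
  (Σ (Fin n → Fin 5) λ part → G ⊆ᴱ blowUp C₅ part) → DeletedBlowUp C₅ G
homomorphism⇒deletedBlowUp G ¬bip (part , hom) = part , homomorphism-surjective G part hom ¬bip , hom

dense-non-bipartite⇒deletedBlowUp : (G : Graph n) → TriangleFree G → ∀ {b d} → (∀ v → degree G v ≡ d) →
  ¬ Bipartite G → n * 2 ≤ 5 * d + b → 45 * b < n → DeletedBlowUp C₅ G
dense-non-bipartite⇒deletedBlowUp {n} G free {b} {d} deg ¬bip 2n≤5d+b 45b<n =
  from (closedWalk₅-or-bipartite G free (Fin.fromℕ< (≤-<-trans z≤n 45b<n)) deg (n<3d b d 2n≤5d+b 45b<n))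
  where
  from : ∃ (ClosedWalk₅ G) ⊎ Bipartite G → DeletedBlowUp C₅ G
  from (inj₂ bip)        = contradiction bip ¬bip
  from (inj₁ (c , walk)) = homomorphism⇒deletedBlowUp G ¬bip
    (homomorphism-to-C₅ (8β<d b d 2n≤5d+b 45b<n {β} β+5d≤2n) (9β+2d<n b d 2n≤5d+b 45b<n {β} β+5d≤2n))
    where open NearExtremal G free deg c walk

module Odd (H : Graph h) (acyclic : Acyclic H) (m′ j : ℕ) (j≤m : j ≤ suc m′) (j≤4 : j ≤ 4)
           {b : ℕ} (5h+16≤b : 5 * h + 16 ≤ b) (large : 45 * b < 5 * suc m′ + 2 * j)
           (odd : 2 ∤ 5 * suc m′ + 2 * j) where

  open Example m′ j j≤m

  private
    m = suc m′

  graph-regular : Regular graph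
  graph-regular = m * 2 , graph-degree

  graph-triangleFree : TriangleFree graph
  graph-triangleFree = deletedBlowUp-triangleFree graph deletedBlowUp

  -- Twice the order is 10m + 4j, with 4j ≤ 16, and 10m is below 5d + 5h; hence `5 * h + 16` as the
  -- lower bound for `b`.
  2n≤5d+b : ∀ {d} → m * 2 < d + h → order * 2 ≤ 5 * d + b
  2n≤5d+b {d} 2m<d+h = begin
    order * 2                    ≡⟨ solve 2 (λ m j → (con 5 :* m :+ con 2 :* j) :* con 2
          := con 5 :* (m :* con 2) :+ con 4 :* j) refl m j ⟩
    5 * (m * 2) + 4 * j          ≤⟨ +-mono-≤ (*-monoʳ-≤ 5 (<⇒≤ 2m<d+h)) (*-monoʳ-≤ 4 j≤4) ⟩
    5 * (d + h) + 16             ≡⟨ trans (cong (_+ 16) (*-distribˡ-+ 5 d h)) (+-assoc (5 * d) (5 * h) 16) ⟩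
    5 * d + (5 * h + 16)         ≤⟨ +-monoʳ-≤ (5 * d) 5h+16≤b ⟩
    5 * d + b                    ∎
    where open ≤-Reasoning

  Conclusion : Set₁
  Conclusion = Σ (Graph order) λ G* → Regular G* × DeletedBlowUp C₅ G* × IsRex order H (K 3) (𝒩 H G*)

  module _ (G : Graph order) (free : TriangleFree G) {d : ℕ} (deg : ∀ v → degree G v ≡ d)
           (max : ∀ (G′ : Graph order) → TriangleFree G′ → Regular G′ → 𝒩 H G′ ≤ 𝒩 H G) where

    -- The explicit graph has at least as many copies as the maximiser `G`, hence is a maximiser
    -- itself, now of the required form.
    sparse-maximiser : d + h ≤ m * 2 → Conclusion
    sparse-maximiser d+h≤2m = graph , graph-regular , deletedBlowUp ,
      (graph , triangleFree⇒K₃-free graph graph-triangleFree , graph-regular , refl) ,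
      λ { _ (G′ , free′ , reg′ , refl) → ≤-trans (max G′ (K₃-free⇒triangleFree G′ free′) reg′)
            (𝒩-≤-degree H G graph (acyclic-freelyExtends H acyclic graph) deg graph-degree d+h≤2m) }

    dense-maximiser : m * 2 < d + h → Conclusion
    dense-maximiser 2m<d+h = G , (d , deg) , dense-non-bipartite⇒deletedBlowUp G free deg ¬bipartite dense large ,
      (G , triangleFree⇒K₃-free G free , (d , deg) , refl) ,
      λ { _ (G′ , free′ , reg′ , refl) → max G′ (K₃-free⇒triangleFree G′ free′) reg′ }
      where
      dense : order * 2 ≤ 5 * d + b
      dense = 2n≤5d+b 2m<d+h

      ¬bipartite : ¬ Bipartite G
      -- Evenness of the order needs positive degree, which follows from 8b < d.
      ¬bipartite bip = odd (regular-bipartite⇒even G bip ⦃ >-nonZero (≤-<-trans z≤n (8b<d b d dense large)) ⦄ deg)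

    conclusion-from : Dec (d + h ≤ m * 2) → Conclusion
    conclusion-from (yes p) = sparse-maximiser p
    conclusion-from (no ¬p) = dense-maximiser (≰⇒> ¬p)

  conclusion : Conclusion
  conclusion =
    let G , free , (d , deg) , max =
          maximiser H (Fin.fromℕ< (≤-<-trans z≤n large)) graph graph-triangleFree graph-regular
    in conclusion-from G free deg max (d + h ≤? m * 2)

proposition1p7 : ∀ {h : ℕ} (H : Graph h) →
    (Bipartite H →
    ∃[ n₀ ] ∀ n → n₀ < n → 2 ∣ n →
    IsRex n H (K 3) (𝒩 H (T₂ n)))
    ×
    (IsTree H →
    ∃[ n₀ ] ∀ n → n₀ < n → 2 ∤ n →
    Σ (Graph n) λ G* →
    Regular G* × DeletedBlowUp C₅ G* × IsRex n H (K 3) (𝒩 H G*))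
proposition1p7 {h} H = (λ bipartite → 10 * h , even bipartite) , λ (_ , _ , acyclic) → 45 * b , odd acyclic
  where
  b = 5 * h + 16

  even : Bipartite H → ∀ n → 10 * h < n → 2 ∣ n → IsRex n H (K 3) (𝒩 H (T₂ n))
  even bipartite n large (divides m n≡m*2) = subst (λ n → IsRex n H (K 3) (𝒩 H (T₂ n))) (sym n≡m+m)
    (Even.isRex H bipartite {m} (subst (10 * h <_) n≡m+m large))
    where
    n≡m+m : n ≡ m + m
    n≡m+m = trans n≡m*2 (solve 1 (λ m → m :* con 2 := m :+ m) refl m)

  Goal : ℕ → Set₁
  Goal n = Σ (Graph n) λ G* → Regular G* × DeletedBlowUp C₅ G* × IsRex n H (K 3) (𝒩 H G*)

  odd : Acyclic H → ∀ n → 45 * b < n → 2 ∤ n → Goal n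
  odd acyclic n large 2∤n = from (five-two (n ∸ 24))
    where
    24≤n : 24 ≤ n
    24≤n = begin
      24           ≤⟨ m≤m+n 24 8 ⟩
      2 * 16       ≤⟨ *-mono-≤ (m≤m+n 2 43) (m≤n+m 16 (5 * h)) ⟩
      45 * b       ≤⟨ <⇒≤ large ⟩
      n            ∎
      where open ≤-Reasoning

    from : (∃₂ λ m j → 24 + (n ∸ 24) ≡ 5 * m + 2 * j × j ≤ 4 × 4 ≤ m) → Goal n
    from (suc m′ , j , e , j≤4 , 4≤m) = subst Goal (sym n≡)
      (Odd.conclusion H acyclic m′ j (≤-trans j≤4 4≤m) j≤4 {b} ≤-refl
        (subst (45 * b <_) n≡ large) (subst (2 ∤_) n≡ 2∤n))
      where
      n≡ : n ≡ 5 * suc m′ + 2 * j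
      n≡ = trans (sym (m+[n∸m]≡n 24≤n)) e
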